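{- Let $H$ be the graph on vertex set $\{0,1,2,3\}$ with red edge set $\{\{0,2\}\}$ and blue edge set $\{\{0,1\},\{0,3\},\{1,3\}\}$. For every $\varepsilon>0$ there are $\delta>0$ and $n_0$ such that every graph $G$ with $n\ge n_0$ vertices that satisfies $\lambda_H(G)\ge 1/8-\delta$ is within edit distance at most $\varepsilon n^2$ from the complete bipartite graph with parts of sizes $\lfloor n/2\rfloor$ and $\lceil n/2\rceil$.
   Context: All graphs are finite and simple. For a graph $H$ with $\kappa$ vertices whose edges are coloured red or blue and an uncoloured graph $G$ with $n\ge\kappa$ vertices, an embedding of $H$ into $G$ is an injection $V(H)\to V(G)$ that maps red edges of $H$ to edges of $G$ and blue edges of $H$ to non-edges of $G$ (pairs of distinct non-adjacent vertices). $\Lambda_H(G)$ is the number of embeddings and $\lambda_H(G):=\Lambda_H(G)/\big(n(n-1)\cdots(n-\kappa+1)\big)$. The edit distance between two graphs $G,G'$ with the same number of vertices is the minimum of $|f(E(G))\bigtriangleup E(G')|$ over all bijections $f:V(G)\to V(G')$. -}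

module Defs where

open import Data.Bool.Base using (true)
open import Data.Fin.Base using (Fin; toℕ)
open import Data.Fin.Patterns using (0F; 1F; 2F; 3F)
open import Data.Fin.Properties using (_≟_; _<?_; all?; any?)
open import Data.Integer.Base using (+_)
open import Data.List.Base
  using (List; [_]; length; map; filter; allFin; cartesianProduct; cartesianProductWith)
open import Data.List.Extrema.Nat using (min)
open import Data.Maybe.Base using (Maybe; just; nothing)
open import Data.Maybe.Properties using (≡-dec)
open import Data.Nat.Base as ℕ using (ℕ; zero; suc; NonZero; ⌊_/2⌋)
open import Data.Nat.Combinatorics using (_P_)
open import Data.Nat.Combinatorics.Base using (_P′_)
import Data.Nat.Properties as ℕ
open import Data.Product.Base using (_×_; _,_; ∃₂)
open import Data.Rational.Base using (ℚ; _/_)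
open import Data.Sum.Base using (_⊎_; inj₁; inj₂)
import Data.Vec.Functional as Vector
open import Function.Base using (id)
open import Function.Definitions using (Injective; StrictlySurjective)
open import Level using (0ℓ)
open import Relation.Binary.Core using (Rel)
open import Relation.Binary.Definitions using (Symmetric; Irreflexive; Decidable; DecidableEquality)
open import Relation.Binary.PropositionalEquality.Core using (_≡_; _≢_; refl)
open import Relation.Nullary.Decidable
  using (Dec; yes; no; map′; from-yes; ¬?; _×-dec_; _⊎-dec_; _→-dec_)
open import Relation.Nullary.Negation.Core using (¬_)

record Graph (n : ℕ) : Set₁ where
  field
    Adj    : Rel (Fin n) 0ℓ
    Adj?   : Decidable Adj
    sym    : Symmetric Adj
    irrefl : Irreflexive _≡_ Adj

open Graph

data Colour : Set where
  red blue : Colour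

_≟ᶜ_ : DecidableEquality Colour
red  ≟ᶜ red  = yes refl
red  ≟ᶜ blue = no λ ()
blue ≟ᶜ red  = no λ ()
blue ≟ᶜ blue = yes refl

_≟ᵐ_ : DecidableEquality (Maybe Colour)
_≟ᵐ_ = ≡-dec _≟ᶜ_

-- `colour i j` is `nothing` when {i , j} is not an edge.
record ColouredGraph (κ : ℕ) : Set where
  field
    colour : Fin κ → Fin κ → Maybe Colour
    sym    : ∀ i j → colour i j ≡ colour j i
    irrefl : ∀ i → colour i i ≡ nothing

open ColouredGraph using (colour)

-- Every function Fin k → Fin n occurs exactly once in the list, up to
-- pointwise equality.
functions : ∀ k n → List (Fin k → Fin n)
functions zero    n = [ Vector.[] ]
functions (suc k) n = cartesianProductWith Vector._∷_ (allFin n) (functions k n)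

injective? : ∀ {k n} (f : Fin k → Fin n) → Dec (Injective _≡_ _≡_ f)
injective? f = map′ (λ p {x} {y} → p x y) (λ p x y → p {x} {y})
  (all? λ x → all? λ y → (f x ≟ f y) →-dec (x ≟ y))

strictlySurjective? : ∀ {k n} (f : Fin k → Fin n) → Dec (StrictlySurjective _≡_ f)
strictlySurjective? f = all? λ y → any? λ x → f x ≟ y

module _ {κ n : ℕ} (H : ColouredGraph κ) (G : Graph n) where

  IsEmbedding : (Fin κ → Fin n) → Set
  IsEmbedding f =
      Injective _≡_ _≡_ f
    × (∀ i j → colour H i j ≡ just red  → Adj G (f i) (f j))
    × (∀ i j → colour H i j ≡ just blue → f i ≢ f j × ¬ Adj G (f i) (f j))

  isEmbedding? : ∀ f → Dec (IsEmbedding f)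
  isEmbedding? f =
    injective? f
    ×-dec (all? λ i → all? λ j → (colour H i j ≟ᵐ just red) →-dec Adj? G (f i) (f j))
    ×-dec (all? λ i → all? λ j → (colour H i j ≟ᵐ just blue)
             →-dec (¬? (f i ≟ f j) ×-dec ¬? (Adj? G (f i) (f j))))

  embeddingCount : ℕ
  embeddingCount = length (filter isEmbedding? (functions κ n))

P′-nonZero : ∀ {n} k → k ℕ.≤ n → NonZero (n P′ k)
P′-nonZero         zero    _   = _
P′-nonZero {n = n} (suc k) k<n =
  ℕ.m*n≢0 (n ℕ.∸ k) (n P′ k)
    {{ℕ.>-nonZero (ℕ.m<n⇒0<n∸m k<n)}} {{P′-nonZero k (ℕ.<⇒≤ k<n)}}

P-nonZero : ∀ {n} k → k ℕ.≤ n → NonZero (n P k)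
P-nonZero {n} k k≤n with k ℕ.≤ᵇ n | ℕ.≤⇒≤ᵇ k≤n
... | true  | _ = P′-nonZero k k≤n

-- λ_H(G); the library's n P κ is n (n - 1) ⋯ (n - κ + 1).
embeddingDensity : ∀ {κ n} → ColouredGraph κ → Graph n → .(κ ℕ.≤ n) → ℚ
embeddingDensity {κ} {n} H G κ≤n =
  _/_ (+ embeddingCount H G) (n P κ) {{P-nonZero κ κ≤n}}

IsBijection : ∀ {n} → (Fin n → Fin n) → Set
IsBijection f = Injective _≡_ _≡_ f × StrictlySurjective _≡_ f

isBijection? : ∀ {n} (f : Fin n → Fin n) → Dec (IsBijection f)
isBijection? f = injective? f ×-dec strictlySurjective? f

bijections : ∀ n → List (Fin n → Fin n)
bijections n = filter isBijection? (functions n n)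

module _ {n : ℕ} (G G′ : Graph n) where

  InImage : (Fin n → Fin n) → Fin n → Fin n → Set
  InImage f x y = ∃₂ λ u v → f u ≡ x × f v ≡ y × Adj G u v

  inImage? : ∀ f x y → Dec (InImage f x y)
  inImage? f x y = any? λ u → any? λ v → (f u ≟ x) ×-dec (f v ≟ y) ×-dec Adj? G u v

  InDifference : (Fin n → Fin n) → Fin n × Fin n → Set
  InDifference f (x , y) =
    (InImage f x y × ¬ Adj G′ x y) ⊎ (¬ InImage f x y × Adj G′ x y)

  inDifference? : ∀ f e → Dec (InDifference f e)
  inDifference? f (x , y) =
    (inImage? f x y ×-dec ¬? (Adj? G′ x y)) ⊎-dec (¬? (inImage? f x y) ×-dec Adj? G′ x y)

  -- |f(E(G)) △ E(G′)|; each unordered pair {x , y} is counted once, as x < y.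
  differenceSize : (Fin n → Fin n) → ℕ
  differenceSize f =
    length (filter (λ { e@(x , y) → (x <? y) ×-dec inDifference? f e })
                   (cartesianProduct (allFin n) (allFin n)))

  -- `min` takes a default value; the value at the identity is one of those
  -- being minimised over.
  editDistance : ℕ
  editDistance = min (differenceSize id) (map differenceSize (bijections n))

-- The parts are {i | i < ⌊n/2⌋}, of size ⌊n/2⌋, and its complement, of size
-- n - ⌊n/2⌋ = ⌈n/2⌉.
balancedCompleteBipartite : ∀ n → Graph n
balancedCompleteBipartite n = record
  { Adj    = λ i j → (Left i × ¬ Left j) ⊎ (¬ Left i × Left j)
  ; Adj?   = λ i j → (left? i ×-dec ¬? (left? j)) ⊎-dec (¬? (left? i) ×-dec left? j)
  ; sym    = λ { (inj₁ (p , q)) → inj₂ (q , p) ; (inj₂ (p , q)) → inj₁ (q , p) }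
  ; irrefl = λ { refl (inj₁ (p , q)) → q p ; refl (inj₂ (p , q)) → p q }
  }
  where
  Left : Fin n → Set
  Left i = toℕ i ℕ.< ⌊ n /2⌋

  left? : ∀ i → Dec (Left i)
  left? i = toℕ i ℕ.<? ⌊ n /2⌋

H : ColouredGraph 4
H = record
  { colour = c
  ; sym    = from-yes (all? λ i → all? λ j → c i j ≟ᵐ c j i)
  ; irrefl = from-yes (all? λ i → c i i ≟ᵐ nothing)
  }
  where
  c : Fin 4 → Fin 4 → Maybe Colour
  c 0F 2F = just red
  c 2F 0F = just red
  c 0F 1F = just blue
  c 1F 0F = just blue
  c 0F 3F = just blue
  c 3F 0F = just blue
  c 1F 3F = just blue
  c 3F 1F = just blue
  c _  _  = nothing

{-# OPTIONS --safe #-}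
-- An embedding of H is an edge x₀x₂ together with two vertices x₁, x₃ such that
-- x₀, x₁, x₃ are independent. Hence, with d for degrees, there are at most
--   Λ = ∑ₓ d(x) ((n - d(x))² - r(x))
-- of them, r(x) being the number of ordered edges that avoid the neighbourhood
-- of x. Since r(x) = e - 2 s(x) + t(x), where e is the degree sum, s(x) the
-- degree sum over the neighbours of x and t(x) the number of ordered triangles
-- at x, the deficit n⁴ - 8Λ is (up to scaling) a sum over all pairs of vertices
-- of a slack that depends only on adjacency, degrees and codegree; the identity
-- for r and the identity ∑ᵧ R(x,y) = d(x) may be added with multipliers that
-- depend on the degree. For suitable polynomial multipliers every slack is
-- non-negative, and is large unless the degrees are n/2. So a small deficit
-- forces ∑ (2d - n)² to be small.
--
-- With the constant multiplier n/4 the identity for r then shows that r(x) + t(x)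
-- is small on average: triples spanning one or three edges are rare. For such a
-- vertex v the graph is close to the complete bipartite graph between the
-- neighbourhood of v and its complement, and both have size about n/2.
module Submission where

open import Defs
open import Algebra.Bundles using (CommutativeRing)
import Algebra.Properties.CommutativeMonoid.Sum as CommutativeMonoidSum
import Algebra.Properties.Semiring.Sum as SemiringSum
open import Data.Bool.Base using (Bool; true; false; T; if_then_else_; _∧_; _∨_; not)
open import Data.Bool.Properties using (T-∧)
open import Data.Fin.Base using (Fin; zero; suc; toℕ; punchIn; fromℕ<)
open import Data.Fin.Patterns using (0F; 1F; 2F; 3F)
open import Data.Fin.Permutation as Permutation
  using (Permutation; _⟨$⟩ʳ_; _⟨$⟩ˡ_; lift₀; insert; inverseˡ; inverseʳ)
import Data.Fin.Properties as Fin
open import Data.Integer.Base as ℤ using (ℤ; +_; -[1+_]; +[1+_]; 0ℤ; 1ℤ; ∣_∣; +≤+; +<+)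
import Data.Integer.Properties as ℤ
open import Data.Integer.Solver using (module +-*-Solver)
open import Data.Integer.Tactic.RingSolver using (solve-∀)
open import Data.List.Base
  using (List; []; _∷_; _++_; map; foldr; filter; length; allFin; tabulate;
         cartesianProduct; cartesianProductWith)
import Data.List.Extrema as Extrema
open import Data.List.Membership.Propositional using (_∈_; lose)
open import Data.List.Membership.Propositional.Properties
  using (∈-map⁺; ∈-filter⁺; ∈-allFin; ∈-cartesianProductWith⁺)
open import Data.List.Relation.Unary.Any using (here)
open import Data.Nat.Base as ℕ using (ℕ; zero; suc; z≤n; s≤s; ⌊_/2⌋)
open import Data.Nat.Combinatorics using (_P_)
import Data.Nat.Properties as ℕ
open import Data.Product.Base using (_×_; _,_; proj₁; proj₂; ∃-syntax)
import Data.Rational.Properties as ℚ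
open import Data.Rational.Unnormalised.Base as ℚᵘ using (mkℚᵘ)
import Data.Rational.Unnormalised.Properties as ℚᵘ
open import Data.Sum.Base using (_⊎_; inj₁; inj₂; [_,_]′)
open import Data.Vec.Base using (Vec; []; _∷_; lookup)
import Data.Vec.Functional as Vector
open import Data.Vec.Relation.Unary.All using (All; []; _∷_)
open import Function.Base using (_∘_; id)
open import Function.Bundles using (Equivalence)
open import Level using (0ℓ)
open import Relation.Binary.PropositionalEquality
  using (_≡_; _≗_; refl; subst; subst₂; cong; cong₂; trans; sym; module ≡-Reasoning)
open import Relation.Nullary.Decidable using (Dec; yes; no; does; from-yes; _×-dec_)
open import Relation.Nullary.Negation using (¬_; contradiction)
open import Relation.Unary using (Pred; Decidable)
open +-*-Solver using
  ( Polynomial; HNF; Normal; ∅; _*x+_; poly; ⟦_⟧; ⟦_⟧H; ⟦_⟧N; normalise; correct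
  ; var; op; [+]; [*]; :-_; _:+_; _:*_; _:^_ )
  renaming (con to conᴾ)

-- Polynomials with non-negative coefficients.

0≤i+j : ∀ {i j} → 0ℤ ℤ.≤ i → 0ℤ ℤ.≤ j → 0ℤ ℤ.≤ i ℤ.+ j
0≤i+j = ℤ.+-mono-≤

0≤i*j : ∀ {i j} → 0ℤ ℤ.≤ i → 0ℤ ℤ.≤ j → 0ℤ ℤ.≤ i ℤ.* j
0≤i*j {+ m} {+ n} _ _ = subst (0ℤ ℤ.≤_) (ℤ.pos-* m n) (+≤+ z≤n)

-- The formulas below are written over an arbitrary carrier, so that the same
-- text denotes an integer and, with variables for arguments, a polynomial.
record Arithmetic (A : Set) : Set where
  infixl 6 _+_ _-_
  infixl 7 _*_
  infixr 9 _^_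
  infix  8 -_
  field
    _+_ _*_ : A → A → A
    -_      : A → A
    _^_     : A → ℕ → A
    con     : ℤ → A
  _-_ : A → A → A
  x - y = x + (- y)

integers : Arithmetic ℤ
integers = record
  { _+_ = ℤ._+_ ; _*_ = ℤ._*_ ; -_ = ℤ.-_ ; _^_ = ℤ._^_ ; con = λ i → i }

polynomials : ∀ m → Arithmetic (Polynomial m)
polynomials m = record
  { _+_ = _:+_ ; _*_ = _:*_ ; -_ = :-_ ; _^_ = _:^_ ; con = conᴾ }

module _ {A : Set} (arithmetic : Arithmetic A) where
  open Arithmetic arithmetic

  eval : ∀ {m} → Polynomial m → Vec A m → A
  eval (op [+] p q) ρ = eval p ρ + eval q ρ
  eval (op [*] p q) ρ = eval p ρ * eval q ρ
  eval (conᴾ i)     ρ = con i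
  eval (var x)      ρ = lookup ρ x
  eval (p :^ k)     ρ = eval p ρ ^ k
  eval (:- p)       ρ = - eval p ρ

eval-correct : ∀ {m} (p : Polynomial m) ρ → eval integers p ρ ≡ ⟦ p ⟧ ρ
eval-correct (op [+] p q) ρ = cong₂ ℤ._+_ (eval-correct p ρ) (eval-correct q ρ)
eval-correct (op [*] p q) ρ = cong₂ ℤ._*_ (eval-correct p ρ) (eval-correct q ρ)
eval-correct (conᴾ i)     ρ = refl
eval-correct (var x)      ρ = refl
eval-correct (p :^ k)     ρ = trans (cong (ℤ._^ k) (eval-correct p ρ)) (power k)
  where
  power : ∀ k → ⟦ p ⟧ ρ ℤ.^ k ≡ ⟦ p :^ k ⟧ ρ
  power zero    = refl
  power (suc k) = cong (⟦ p ⟧ ρ ℤ.*_) (power k)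
eval-correct (:- p)       ρ = cong ℤ.-_ (eval-correct p ρ)

mutual
  nonnegH : ∀ {m} → HNF (suc m) → Bool
  nonnegH ∅         = true
  nonnegH (p *x+ c) = nonnegH p ∧ nonnegN c

  nonnegN : ∀ {m} → Normal m → Bool
  nonnegN (Normal.con c) = 0ℤ ℤ.≤ᵇ c
  nonnegN (poly p)       = nonnegH p

mutual
  nonnegH-sound : ∀ {m} (p : HNF (suc m)) {ρ} →
    All (0ℤ ℤ.≤_) ρ → T (nonnegH p) → 0ℤ ℤ.≤ ⟦ p ⟧H ρ
  nonnegH-sound ∅         _                 _ = ℤ.≤-refl
  nonnegH-sound (p *x+ c) 0≤ρ@(0≤x ∷ 0≤ρ′) t =
    let tp , tc = Equivalence.to T-∧ t in
    0≤i+j (0≤i*j (nonnegH-sound p 0≤ρ tp) 0≤x) (nonnegN-sound c 0≤ρ′ tc)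

  nonnegN-sound : ∀ {m} (p : Normal m) {ρ} →
    All (0ℤ ℤ.≤_) ρ → T (nonnegN p) → 0ℤ ℤ.≤ ⟦ p ⟧N ρ
  nonnegN-sound (Normal.con c) _   t = ℤ.≤ᵇ⇒≤ t
  nonnegN-sound (poly p)       0≤ρ t = nonnegH-sound p 0≤ρ t

-- The sign of an integer expression is read off a normal form: for a closed p the premise on
-- `nonnegN` evaluates to the unit type, so `_` proves it.
nonneg-coefficients : ∀ {m} (p : Polynomial m) ρ {i} → eval integers p ρ ≡ i →
  T (nonnegN (normalise p)) → All (0ℤ ℤ.≤_) ρ → 0ℤ ℤ.≤ i
nonneg-coefficients p ρ refl t 0≤ρ = subst (0ℤ ℤ.≤_)
  (trans (correct p ρ) (sym (eval-correct p ρ)))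
  (nonnegN-sound (normalise p) 0≤ρ t)

-- Multipliers, slacks and gains.

module Forms {A : Set} (arithmetic : Arithmetic A) where
  open Arithmetic arithmetic

  excess : A → A → A
  excess n d = con (+ 2) * d - n

  -- The multipliers of ∑ᵧ R(x,y) = d(x) and of r = e - 2s + t. Near d = n/2 the
  -- first few coefficients are forced; the others come from a linear program.
  degreeMultiplier : A → A → A
  degreeMultiplier n d =
    con (+ 16) * v ^ 2 * n ^ 4 - con (+ 8) * n ^ 6 - con (+ 6) * v ^ 4 * n ^ 2
      - con (+ 4) * v ^ 5 * n - con (+ 3) * v ^ 6
    where v = excess n d

  codegreeMultiplier : A → A → A
  codegreeMultiplier n d =
    con (+ 8) * n ^ 4 - con (+ 8) * v * n ^ 3 - con (+ 16) * v ^ 2 * n ^ 2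
      + con (+ 8) * v ^ 3 * n + con (+ 13) * v ^ 4
    where v = excess n d

  -- Completing the square twice in `codegreeMultiplier`, as a polynomial in v and n; the remainder
  -- comes to 481 n⁴.
  codegreeSquare₁ codegreeSquare₂ codegreeRemainder : A → A → A
  codegreeSquare₁ n d = con (+ 26) * v ^ 2 + con (+ 8) * n * v - con (+ 19) * n ^ 2
    where v = excess n d
  codegreeSquare₂ n d = (con (+ 46) * v - con (+ 28) * n) * n
    where v = excess n d
  codegreeRemainder n d = con (+ 1196) * codegreeMultiplier n d
    - (con (+ 23) * (codegreeSquare₁ n d * codegreeSquare₁ n d)
      + codegreeSquare₂ n d * codegreeSquare₂ n d)

  base : A → A → A → A
  base n d D =
    con (+ 8) * n ^ 7 - con (+ 32) * n ^ 4 * (d * (n - d) ^ 2 + D * (n - D) ^ 2)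

  -- Over all ordered pairs of vertices, `redForm` on the edges and `blueForm` on
  -- the other pairs add up to 8n⁵(n⁴ - 8Λ), for all multipliers α and π.
  blueConstant : (n d D α α′ : A) → A
  blueConstant n d D α α′ =
    base n d D + con (+ 64) * n ^ 5 * d * D + d * α + D * α′

  blueSlope : (n d D π π′ : A) → A
  blueSlope n d D π π′ = con (+ 32) * n ^ 5 * (d + D) - n ^ 2 * (π + π′)

  blueForm redForm : (n d D c α α′ π π′ : A) → A
  blueForm n d D c α α′ π π′ = blueConstant n d D α α′ - c * blueSlope n d D π π′
  redForm n d D c α α′ π π′ =
    base n d D - n ^ 2 * (π * (D - c) + π′ * (d - c)) - (n - d) * α - (n - D) * α′

  blueSlack redSlack : (n d D c : A) → A
  blueSlack n d D c = blueForm n d D c (degreeMultiplier n d) (degreeMultiplier n D)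
    (codegreeMultiplier n d) (codegreeMultiplier n D)
  redSlack n d D c = redForm n d D c (degreeMultiplier n d) (degreeMultiplier n D)
    (codegreeMultiplier n d) (codegreeMultiplier n D)

  -- Margins by which the slacks are positive. Apart from a factor in n alone, each is a product of
  -- one factor per end, so that its sum over all ordered pairs is a multiple of a square.
  blueGain redGain : (n d D : A) → A
  blueGain n d D = con (+ 2) * n ^ 3 * excess n d ^ 2 * excess n D ^ 2
  redGain  n d D = con (+ 2) * n * d * D * excess n d ^ 2 * excess n D ^ 2

-- The triangle 0 ≤ d ≤ D ≤ n is cut by the lines 2D + d = n, 2D = n and
-- d + D = n, so that every zero of the slacks is a vertex of a cell. In the
-- coordinates x, y, z of a cell the slacks then have no negative coefficient.
data Cell : Set where
  cell₁ cell₂ cell₃ cell₄ : Cell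

-- The blue form is affine in the codegree, so the two ends of the range of codegrees, max(0, d + D
-- - n) and d, suffice. The red form does not decrease with the codegree, so the lower end suffices.
data Kind : Set where
  blueLeast blueGreatest redLeast : Kind

module Coordinates {A : Set} (arithmetic : Arithmetic A) where
  open Arithmetic arithmetic
  open Forms arithmetic

  order low high least : Cell → (x y z : A) → A

  order cell₁ x y z = con (+ 3) * x + con (+ 2) * y + z
  order cell₂ x y z = con (+ 2) * x + con (+ 2) * y + con (+ 3) * z
  order cell₃ x y z = con (+ 2) * x + con (+ 2) * y + z
  order cell₄ x y z = con (+ 2) * x + y + z

  low cell₁ x y z = x
  low cell₂ x y z = x + z
  low cell₃ x y z = x
  low cell₄ x y z = x + y

  high cell₁ x y z = x + y
  high cell₂ x y z = x + y + z
  high cell₃ x y z = x + y + z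
  high cell₄ x y z = x + y + z

  least cell₁ x y z = con 0ℤ
  least cell₂ x y z = con 0ℤ
  least cell₃ x y z = con 0ℤ
  least cell₄ x y z = y

  margin : Kind → (n d D c : A) → A
  margin blueLeast    n d D c = blueSlack n d D c - blueGain n d D
  margin blueGreatest n d D c = blueSlack n d D d - blueGain n d D
  margin redLeast     n d D c = redSlack n d D c - redGain n d D

  cellMargin : Kind → Cell → (x y z : A) → A
  cellMargin kind cell x y z =
    margin kind (order cell x y z) (low cell x y z) (high cell x y z) (least cell x y z)

open Forms integers
open Coordinates integers

marginPolynomial : Kind → Cell → Polynomial 3
marginPolynomial kind cell =
  Coordinates.cellMargin (polynomials 3) kind cell (var 0F) (var 1F) (var 2F)

-- The arithmetic is arbitrary, so its operations are inert and `refl` merely compares two formulas;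
-- the case split lets the coordinates of each cell unfold.
marginPolynomial-correct : ∀ {A} (arithmetic : Arithmetic A) kind cell x y z →
  eval arithmetic (marginPolynomial kind cell) (x ∷ y ∷ z ∷ [])
    ≡ Coordinates.cellMargin arithmetic kind cell x y z
marginPolynomial-correct arithmetic blueLeast    cell₁ x y z = refl
marginPolynomial-correct arithmetic blueLeast    cell₂ x y z = refl
marginPolynomial-correct arithmetic blueLeast    cell₃ x y z = refl
marginPolynomial-correct arithmetic blueLeast    cell₄ x y z = refl
marginPolynomial-correct arithmetic blueGreatest cell₁ x y z = refl
marginPolynomial-correct arithmetic blueGreatest cell₂ x y z = refl
marginPolynomial-correct arithmetic blueGreatest cell₃ x y z = refl
marginPolynomial-correct arithmetic blueGreatest cell₄ x y z = refl
marginPolynomial-correct arithmetic redLeast     cell₁ x y z = refl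
marginPolynomial-correct arithmetic redLeast     cell₂ x y z = refl
marginPolynomial-correct arithmetic redLeast     cell₃ x y z = refl
marginPolynomial-correct arithmetic redLeast     cell₄ x y z = refl

marginPolynomial-nonneg : ∀ kind cell → T (nonnegN (normalise (marginPolynomial kind cell)))
marginPolynomial-nonneg blueLeast    cell₁ = _
marginPolynomial-nonneg blueLeast    cell₂ = _
marginPolynomial-nonneg blueLeast    cell₃ = _
marginPolynomial-nonneg blueLeast    cell₄ = _
marginPolynomial-nonneg blueGreatest cell₁ = _
marginPolynomial-nonneg blueGreatest cell₂ = _
marginPolynomial-nonneg blueGreatest cell₃ = _
marginPolynomial-nonneg blueGreatest cell₄ = _
marginPolynomial-nonneg redLeast     cell₁ = _
marginPolynomial-nonneg redLeast     cell₂ = _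
marginPolynomial-nonneg redLeast     cell₃ = _
marginPolynomial-nonneg redLeast     cell₄ = _

cellMargin-nonneg : ∀ kind cell {x y z} → 0ℤ ℤ.≤ x → 0ℤ ℤ.≤ y → 0ℤ ℤ.≤ z →
  0ℤ ℤ.≤ cellMargin kind cell x y z
cellMargin-nonneg kind cell {x} {y} {z} 0≤x 0≤y 0≤z = nonneg-coefficients
  (marginPolynomial kind cell) (x ∷ y ∷ z ∷ [])
  (marginPolynomial-correct integers kind cell x y z)
  (marginPolynomial-nonneg kind cell) (0≤x ∷ 0≤y ∷ 0≤z ∷ [])

-- Every slack is at least its gain.

module Counting where

  open import Data.Integer.Base using (_+_; _*_; _-_; -_; _^_; _≤_; _<_)

  data Located (n d D : ℤ) : Set where
    located : ∀ cell {x y z} → 0ℤ ≤ x → 0ℤ ≤ y → 0ℤ ≤ z →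
      order cell x y z ≡ n → low cell x y z ≡ d → high cell x y z ≡ D → Located n d D

  locate : ∀ {n d D} → 0ℤ ≤ d → d ≤ D → D ≤ n → Located n d D
  locate {n} {d} {D} 0≤d d≤D D≤n
    with ℤ.≤-total (+ 2 * D) n | ℤ.≤-total (n - + 2 * D) d | ℤ.≤-total (d + D) n
  ... | inj₁ 2D≤n | inj₂ d≤n-2D | _ = located cell₁
    0≤d (ℤ.i≤j⇒0≤j-i d≤D) (ℤ.i≤j⇒0≤j-i d≤n-2D) (eq n d D) refl (eq₁ d D)
    where
    eq : ∀ n d D → + 3 * d + + 2 * (D - d) + (n - + 2 * D - d) ≡ n
    eq = solve-∀
    eq₁ : ∀ d D → d + (D - d) ≡ D
    eq₁ = solve-∀
  ... | inj₁ 2D≤n | inj₁ n-2D≤d | _ = located cell₂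
    (ℤ.i≤j⇒0≤j-i n-2D≤d) (ℤ.i≤j⇒0≤j-i d≤D) (ℤ.i≤j⇒0≤j-i 2D≤n) (eq n d D) (eq₁ n d D) (eq₂ n d D)
    where
    eq : ∀ n d D → + 2 * (d - (n - + 2 * D)) + + 2 * (D - d) + + 3 * (n - + 2 * D) ≡ n
    eq = solve-∀
    eq₁ : ∀ n d D → (d - (n - + 2 * D)) + (n - + 2 * D) ≡ d
    eq₁ = solve-∀
    eq₂ : ∀ n d D → (d - (n - + 2 * D)) + (D - d) + (n - + 2 * D) ≡ D
    eq₂ = solve-∀
  ... | inj₂ n≤2D | _ | inj₁ d+D≤n = located cell₃
    0≤d (ℤ.i≤j⇒0≤j-i d+D≤n) (ℤ.i≤j⇒0≤j-i n≤2D) (eq n d D) refl (eq₂ n d D)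
    where
    eq : ∀ n d D → + 2 * d + + 2 * (n - (d + D)) + (+ 2 * D - n) ≡ n
    eq = solve-∀
    eq₂ : ∀ n d D → d + (n - (d + D)) + (+ 2 * D - n) ≡ D
    eq₂ = solve-∀
  ... | inj₂ n≤2D | _ | inj₂ n≤d+D = located cell₄
    (ℤ.i≤j⇒0≤j-i D≤n) (ℤ.i≤j⇒0≤j-i n≤d+D) (ℤ.i≤j⇒0≤j-i d≤D) (eq n d D) (eq₁ n d D) (eq₂ n d D)
    where
    eq : ∀ n d D → + 2 * (n - D) + (d + D - n) + (D - d) ≡ n
    eq = solve-∀
    eq₁ : ∀ n d D → (n - D) + (d + D - n) ≡ d
    eq₁ = solve-∀
    eq₂ : ∀ n d D → (n - D) + (d + D - n) + (D - d) ≡ D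
    eq₂ = solve-∀

  -- In `cell₄` the value of d + D - n is the coordinate y; in the other cells it is not positive.
  least-≤ : ∀ cell {x y z c} → 0ℤ ≤ c →
    low cell x y z + high cell x y z - order cell x y z ≤ c → least cell x y z ≤ c
  least-≤ cell₁ 0≤c _ = 0≤c
  least-≤ cell₂ 0≤c _ = 0≤c
  least-≤ cell₃ 0≤c _ = 0≤c
  least-≤ cell₄ {x} {y} {z} _ w≤c = subst (_≤ _) (eq x y z) w≤c
    where
    eq : ∀ x y z → (x + y) + (x + y + z) - (+ 2 * x + y + z) ≡ y
    eq = solve-∀

  0≤i*i : ∀ i → 0ℤ ≤ i * i
  0≤i*i (+ m)      = 0≤i*j {+ m} {+ m} (+≤+ z≤n) (+≤+ z≤n)
  0≤i*i (-[1+ m ]) = +≤+ z≤n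

  -- An affine function on an interval is smallest at an end; the sign of the slope K tells which
  -- end to compare with.
  affine-≤ : ∀ X K G {lo hi c} → lo ≤ c → c ≤ hi →
    0ℤ ≤ X - lo * K - G → 0ℤ ≤ X - hi * K - G → G ≤ X - c * K
  affine-≤ X K G {lo} {hi} {c} lo≤c c≤hi 0≤lo 0≤hi with ℤ.≤-total 0ℤ K
  ... | inj₁ 0≤K = ℤ.0≤i-j⇒j≤i (subst (0ℤ ≤_) (eq X K G hi c)
    (0≤i+j {X - hi * K - G} {(hi - c) * K} 0≤hi
      (0≤i*j {hi - c} {K} (ℤ.i≤j⇒0≤j-i {c} {hi} c≤hi) 0≤K)))
    where
    eq : ∀ X K G hi c → X - hi * K - G + (hi - c) * K ≡ X - c * K - G
    eq = solve-∀
  ... | inj₂ K≤0 = ℤ.0≤i-j⇒j≤i (subst (0ℤ ≤_) (eq X K G lo c)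
    (0≤i+j {X - lo * K - G} {(c - lo) * - K} 0≤lo
      (0≤i*j {c - lo} { - K} (ℤ.i≤j⇒0≤j-i {lo} {c} lo≤c) (ℤ.neg-mono-≤ {K} {0ℤ} K≤0))))
    where
    eq : ∀ X K G lo c → X - lo * K - G + (c - lo) * - K ≡ X - c * K - G
    eq = solve-∀

  blueGain≤blueSlack-ordered : ∀ {n d D c} → 0ℤ ≤ d → d ≤ D → D ≤ n →
    0ℤ ≤ c → d + D - n ≤ c → c ≤ d → blueGain n d D ≤ blueSlack n d D c
  blueGain≤blueSlack-ordered {c = c} 0≤d d≤D D≤n = inCell (locate 0≤d d≤D D≤n)
    where
    -- Here n, d and D are general, so that the three equations of `located` can be matched by
    -- `refl`.
    inCell : ∀ {n d D} → Located n d D → 0ℤ ≤ c → d + D - n ≤ c → c ≤ d →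
      blueGain n d D ≤ blueSlack n d D c
    inCell {n} {d} {D} (located cell {x} {y} {z} 0≤x 0≤y 0≤z refl refl refl) 0≤c w≤c c≤d = affine-≤
      (blueConstant n d D (degreeMultiplier n d) (degreeMultiplier n D))
      (blueSlope n d D (codegreeMultiplier n d) (codegreeMultiplier n D))
      (blueGain n d D)
      {least cell x y z} {d} {c}
      (least-≤ cell 0≤c w≤c) c≤d
      (cellMargin-nonneg blueLeast cell 0≤x 0≤y 0≤z)
      (cellMargin-nonneg blueGreatest cell 0≤x 0≤y 0≤z)

  codegreeMultiplier-nonneg : ∀ {n d} → 0ℤ ≤ n → 0ℤ ≤ d → 0ℤ ≤ codegreeMultiplier n d
  codegreeMultiplier-nonneg {n} {d} 0≤n 0≤d = ℤ.*-cancelˡ-≤-pos 0ℤ (codegreeMultiplier n d) (+ 1196)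
    (ℤ.≤-trans {0ℤ} {squares}
      (0≤i+j {+ 23 * (codegreeSquare₁ n d * codegreeSquare₁ n d)} {codegreeSquare₂ n d * codegreeSquare₂ n d}
        (0≤i*j {+ 23} {codegreeSquare₁ n d * codegreeSquare₁ n d} (+≤+ z≤n)
          (0≤i*i (codegreeSquare₁ n d))) (0≤i*i (codegreeSquare₂ n d)))
      (ℤ.0≤i-j⇒j≤i {+ 1196 * codegreeMultiplier n d} {squares} (nonneg-coefficients
        (Forms.codegreeRemainder (polynomials 2) (var 0F) (var 1F)) (n ∷ d ∷ [])
        (agree integers n d) _ (0≤n ∷ 0≤d ∷ []))))
    where
    squares = + 23 * (codegreeSquare₁ n d * codegreeSquare₁ n d) + codegreeSquare₂ n d * codegreeSquare₂ n d
    agree : ∀ {A} (arithmetic : Arithmetic A) n d →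
      eval arithmetic (Forms.codegreeRemainder (polynomials 2) (var 0F) (var 1F)) (n ∷ d ∷ [])
        ≡ Forms.codegreeRemainder arithmetic n d
    agree arithmetic n d = refl

  -- The right side exceeds the left by N (π + π′) (c - lo). The multipliers are variables here, so
  -- that the solver does not expand them.
  red-mono : ∀ b N n d D α α′ π π′ {lo c} → lo ≤ c → 0ℤ ≤ N → 0ℤ ≤ π + π′ → 
    b - N * (π * (D - lo) + π′ * (d - lo)) - (n - d) * α - (n - D) * α′ ≤
    b - N * (π * (D - c) + π′ * (d - c)) - (n - d) * α - (n - D) * α′
  red-mono b N n d D α α′ π π′ {lo} {c} lo≤c 0≤N 0≤π = ℤ.0≤i-j⇒j≤i (subst (0ℤ ≤_) (eq b N n d D α α′ π π′ lo c)
    (0≤i*j {N} {(π + π′) * (c - lo)} 0≤N (0≤i*j {π + π′} {c - lo} 0≤π (ℤ.i≤j⇒0≤j-i {lo} {c} lo≤c))))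
    where
    eq : ∀ b N n d D α α′ π π′ lo c → N * ((π + π′) * (c - lo)) ≡
      b - N * (π * (D - c) + π′ * (d - c)) - (n - d) * α - (n - D) * α′
      - (b - N * (π * (D - lo) + π′ * (d - lo)) - (n - d) * α - (n - D) * α′)
    eq = solve-∀

  0≤i^2 : ∀ i → 0ℤ ≤ i ^ 2
  0≤i^2 i = subst (λ j → 0ℤ ≤ i * j) (sym (ℤ.*-identityʳ i)) (0≤i*i i)

  redGain≤redSlack-ordered : ∀ {n d D c} → 0ℤ ≤ d → d ≤ D → D ≤ n →
    0ℤ ≤ c → d + D - n ≤ c → redGain n d D ≤ redSlack n d D c
  redGain≤redSlack-ordered {c = c} 0≤d d≤D D≤n = inCell (locate 0≤d d≤D D≤n) 0≤d d≤D D≤n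
    where
    inCell : ∀ {n d D} → Located n d D → 0ℤ ≤ d → d ≤ D → D ≤ n →
      0ℤ ≤ c → d + D - n ≤ c → redGain n d D ≤ redSlack n d D c
    inCell {n} {d} {D} (located cell {x} {y} {z} 0≤x 0≤y 0≤z refl refl refl) 0≤d d≤D D≤n 0≤c w≤c =
      ℤ.≤-trans {redGain n d D} {redSlack n d D (least cell x y z)} {redSlack n d D c}
      (ℤ.0≤i-j⇒j≤i {redSlack n d D (least cell x y z)} {redGain n d D}
        (cellMargin-nonneg redLeast cell 0≤x 0≤y 0≤z))
      (red-mono (base n d D) (n ^ 2) n d D
        (degreeMultiplier n d) (degreeMultiplier n D) (codegreeMultiplier n d) (codegreeMultiplier n D)
        {least cell x y z} {c} (least-≤ cell 0≤c w≤c) (0≤i^2 n)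
        (0≤i+j {codegreeMultiplier n d} {codegreeMultiplier n D}
          (codegreeMultiplier-nonneg 0≤n 0≤d) (codegreeMultiplier-nonneg 0≤n 0≤D)))
      where
      0≤D = ℤ.≤-trans 0≤d d≤D
      0≤n = ℤ.≤-trans 0≤D D≤n

  blue-comm : ∀ n d D c α α′ π π′ → blueForm n d D c α α′ π π′ ≡ blueForm n D d c α′ α π′ π
  blue-comm n d D c α α′ π π′ =
    lemma (+ 8 * n ^ 7) (+ 32 * n ^ 4) (d * (n - d) ^ 2) (D * (n - D) ^ 2)
      (+ 64 * n ^ 5) (+ 32 * n ^ 5) (n ^ 2) d D c α α′ π π′
    where
    lemma : ∀ x y g g′ u v m d D c α α′ π π′ →
      ((x - y * (g + g′)) + u * d * D + d * α + D * α′) - c * (v * (d + D) - m * (π + π′)) ≡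
      ((x - y * (g′ + g)) + u * D * d + D * α′ + d * α) - c * (v * (D + d) - m * (π′ + π))
    lemma = solve-∀

  red-comm : ∀ n d D c α α′ π π′ → redForm n d D c α α′ π π′ ≡ redForm n D d c α′ α π′ π
  red-comm n d D c α α′ π π′ =
    lemma (+ 8 * n ^ 7) (+ 32 * n ^ 4) (d * (n - d) ^ 2) (D * (n - D) ^ 2) (n ^ 2) n d D c α α′ π π′
    where
    lemma : ∀ x y g g′ m n d D c α α′ π π′ →
      (x - y * (g + g′)) - m * (π * (D - c) + π′ * (d - c)) - (n - d) * α - (n - D) * α′ ≡
      (x - y * (g′ + g)) - m * (π′ * (d - c) + π * (D - c)) - (n - D) * α′ - (n - d) * α
    lemma = solve-∀

  blueGain-comm : ∀ n d D → blueGain n d D ≡ blueGain n D d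
  blueGain-comm n d D = lemma (+ 2 * n ^ 3) (excess n d ^ 2) (excess n D ^ 2)
    where
    lemma : ∀ x y z → x * y * z ≡ x * z * y
    lemma = solve-∀

  redGain-comm : ∀ n d D → redGain n d D ≡ redGain n D d
  redGain-comm n d D = lemma (+ 2 * n) d D (excess n d ^ 2) (excess n D ^ 2)
    where
    lemma : ∀ m x y z w → m * x * y * z * w ≡ m * y * x * w * z
    lemma = solve-∀

  -- The range of the degrees and the codegree of two vertices; the last bound is
  -- inclusion-exclusion for their neighbourhoods.
  record Admissible (n d D c : ℤ) : Set where
    field
      0≤d : 0ℤ ≤ d
      0≤D : 0ℤ ≤ D
      d≤n : d ≤ n
      D≤n : D ≤ n
      0≤c : 0ℤ ≤ c
      c≤d : c ≤ d
      c≤D : c ≤ D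
      d+D-n≤c : d + D - n ≤ c

  blueSlack-comm : ∀ n d D c → blueSlack n d D c ≡ blueSlack n D d c
  blueSlack-comm n d D c = blue-comm n d D c (degreeMultiplier n d) (degreeMultiplier n D)
    (codegreeMultiplier n d) (codegreeMultiplier n D)

  redSlack-comm : ∀ n d D c → redSlack n d D c ≡ redSlack n D d c
  redSlack-comm n d D c = red-comm n d D c (degreeMultiplier n d) (degreeMultiplier n D)
    (codegreeMultiplier n d) (codegreeMultiplier n D)

  swap-≤ : ∀ (gain slack : ℤ → ℤ → ℤ) → (∀ i j → gain i j ≡ gain j i) → (∀ i j → slack i j ≡ slack j i) →
    ∀ i j → gain j i ≤ slack j i → gain i j ≤ slack i j
  swap-≤ gain slack gain-comm slack-comm i j gain≤slack =
    subst₂ _≤_ (gain-comm j i) (slack-comm j i) gain≤slack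

  blueGain≤blueSlack : ∀ {n d D c} → Admissible n d D c → blueGain n d D ≤ blueSlack n d D c
  blueGain≤blueSlack {n} {d} {D} {c} adm = [ ordered , swapped ]′ (ℤ.≤-total d D)
    where
    open Admissible adm
    ordered : d ≤ D → blueGain n d D ≤ blueSlack n d D c
    ordered d≤D = blueGain≤blueSlack-ordered {n} {d} {D} {c} 0≤d d≤D D≤n 0≤c d+D-n≤c c≤d
    swapped : D ≤ d → blueGain n d D ≤ blueSlack n d D c
    swapped D≤d = swap-≤ (blueGain n) (λ d D → blueSlack n d D c)
      (blueGain-comm n) (λ d D → blueSlack-comm n d D c) d D
      (blueGain≤blueSlack-ordered {n} {D} {d} {c} 0≤D D≤d d≤n 0≤c
        (subst (λ i → i - n ≤ c) (ℤ.+-comm d D) d+D-n≤c) c≤D)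

  redGain≤redSlack : ∀ {n d D c} → Admissible n d D c → redGain n d D ≤ redSlack n d D c
  redGain≤redSlack {n} {d} {D} {c} adm = [ ordered , swapped ]′ (ℤ.≤-total d D)
    where
    open Admissible adm
    ordered : d ≤ D → redGain n d D ≤ redSlack n d D c
    ordered d≤D = redGain≤redSlack-ordered {n} {d} {D} {c} 0≤d d≤D D≤n 0≤c d+D-n≤c
    swapped : D ≤ d → redGain n d D ≤ redSlack n d D c
    swapped D≤d = swap-≤ (redGain n) (λ d D → redSlack n d D c)
      (redGain-comm n) (λ d D → redSlack-comm n d D c) d D
      (redGain≤redSlack-ordered {n} {D} {d} {c} 0≤D D≤d d≤n 0≤c
        (subst (λ i → i - n ≤ c) (ℤ.+-comm d D) d+D-n≤c))

  -- Finite sums of integers.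

  open CommutativeMonoidSum ℤ.+-0-commutativeMonoid using (sum; sum-cong-≗; ∑-distrib-+; ∑-comm)
  open SemiringSum (CommutativeRing.semiring ℤ.+-*-commutativeRing) using (*-distribˡ-sum)

  -- Sealed, so that type checking treats a sum as an atom and never unfolds it.
  opaque
    ∑ : ∀ {n} → (Fin n → ℤ) → ℤ
    ∑ = sum

    ∑-empty : ∀ (f : Fin 0 → ℤ) → ∑ f ≡ 0ℤ
    ∑-empty f = refl

    ∑-suc : ∀ {n} (f : Fin (suc n) → ℤ) → ∑ f ≡ f zero + ∑ (λ i → f (suc i))
    ∑-suc f = refl

    ∑-cong : ∀ {n} {f g : Fin n → ℤ} → (∀ i → f i ≡ g i) → ∑ f ≡ ∑ g
    ∑-cong = sum-cong-≗

    ∑-mono : ∀ {n} {f g : Fin n → ℤ} → (∀ i → f i ≤ g i) → ∑ f ≤ ∑ g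
    ∑-mono {zero}  f≤g = ℤ.≤-refl
    ∑-mono {suc n} f≤g = ℤ.+-mono-≤ (f≤g zero) (∑-mono (λ i → f≤g (suc i)))

    ∑-const : ∀ n k → ∑ {n} (λ _ → k) ≡ + n * k
    ∑-const zero    k = refl
    ∑-const (suc n) k = trans (cong (λ i → k + i) (∑-const n k)) (sym (ℤ.suc-* (+ n) k))

    ∑-+ : ∀ {n} (f g : Fin n → ℤ) → ∑ (λ i → f i + g i) ≡ ∑ f + ∑ g
    ∑-+ = ∑-distrib-+

    ∑-swap : ∀ {m n} (f : Fin m → Fin n → ℤ) → ∑ (λ i → ∑ (f i)) ≡ ∑ (λ j → ∑ (λ i → f i j))
    ∑-swap = ∑-comm

    ∑-*ˡ : ∀ {n} k (f : Fin n → ℤ) → ∑ (λ i → k * f i) ≡ k * ∑ f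
    ∑-*ˡ k f = sym (*-distribˡ-sum k f)

  ∑-nonneg : ∀ {n} {f : Fin n → ℤ} → (∀ i → 0ℤ ≤ f i) → 0ℤ ≤ ∑ f
  ∑-nonneg {n} {f} 0≤f =
    subst (_≤ ∑ f) (trans (∑-const n 0ℤ) (ℤ.*-zeroʳ (+ n))) (∑-mono 0≤f)

  ∑-*ʳ : ∀ {n} k (f : Fin n → ℤ) → ∑ (λ i → f i * k) ≡ ∑ f * k
  ∑-*ʳ k f = trans (∑-cong λ i → ℤ.*-comm (f i) k) (trans (∑-*ˡ k f) (ℤ.*-comm k (∑ f)))

  -- Iterated below to peel a linear combination from its last term.
  ∑-snoc : ∀ {n} (f : Fin n → ℤ) k g → ∑ (λ i → f i + k * g i) ≡ ∑ f + k * ∑ g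
  ∑-snoc f k g = trans (∑-+ f (λ i → k * g i)) (cong (λ i → ∑ f + i) (∑-*ˡ k g))


  -- Degrees, codegrees and the total slack.

  module Weights {N : ℕ} (R : Fin N → Fin N → ℤ)
    (R-bit : ∀ x y → R x y ≡ 0ℤ ⊎ R x y ≡ 1ℤ) (R-sym : ∀ x y → R x y ≡ R y x) where

    n e : ℤ
    n = + N

    -- e - 2 s x + t x counts the ordered edges outside the neighbourhood of x, so
    -- rest x counts the (y , z) with x, y, z pairwise non-adjacent (or equal).
    d s t v² rest : Fin N → ℤ
    c : Fin N → Fin N → ℤ

    d x = ∑ (R x)
    c x y = ∑ λ z → R x z * R y z
    s x = ∑ λ y → R x y * d y
    t x = ∑ λ y → R x y * c x y
    e = ∑ d
    v² x = excess n (d x) ^ 2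
    rest x = (n - d x) ^ 2 - (e - + 2 * s x + t x)

    -- `Δ` is the deficit. `Z` measures how far the degrees are from n/2; `Q` is its degree-weighted
    -- variant, which is bounded first.
    Λ Δ Q Z : ℤ
    Λ = ∑ λ x → d x * rest x
    Δ = n ^ 4 - + 8 * Λ
    Q = ∑ λ x → d x * v² x
    Z = ∑ v²

    0≤n : 0ℤ ≤ n
    0≤n = +≤+ z≤n

    0≤R : ∀ x y → 0ℤ ≤ R x y
    0≤R x y with R x y | R-bit x y
    ... | _ | inj₁ refl = ℤ.≤-refl
    ... | _ | inj₂ refl = +≤+ z≤n

    R≤1 : ∀ x y → R x y ≤ 1ℤ
    R≤1 x y with R x y | R-bit x y
    ... | _ | inj₁ refl = +≤+ z≤n
    ... | _ | inj₂ refl = ℤ.≤-refl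

    0≤d : ∀ x → 0ℤ ≤ d x
    0≤d x = ∑-nonneg (0≤R x)

    d≤n : ∀ x → d x ≤ n
    d≤n x = subst (d x ≤_) (trans (∑-const N 1ℤ) (ℤ.*-identityʳ n)) (∑-mono (R≤1 x))

    c-sym : ∀ x y → c x y ≡ c y x
    c-sym x y = ∑-cong λ z → ℤ.*-comm (R x z) (R y z)

    0≤c : ∀ x y → 0ℤ ≤ c x y
    0≤c x y = ∑-nonneg λ z → 0≤i*j (0≤R x z) (0≤R y z)

    c≤d : ∀ x y → c x y ≤ d x
    c≤d x y = ∑-mono λ z → bit-*-≤ (0≤R x z) (R-bit y z)
      where
      bit-*-≤ : ∀ {i j} → 0ℤ ≤ i → j ≡ 0ℤ ⊎ j ≡ 1ℤ → i * j ≤ i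
      bit-*-≤ {i} 0≤i (inj₁ refl) = subst (_≤ i) (sym (ℤ.*-zeroʳ i)) 0≤i
      bit-*-≤ {i} 0≤i (inj₂ refl) = ℤ.≤-reflexive (ℤ.*-identityʳ i)

    d+d-n≤c : ∀ x y → d x + d y - n ≤ c x y
    d+d-n≤c x y = subst (_≤ c x y) total (∑-mono λ z → bits (R-bit x z) (R-bit y z))
      where
      bits : ∀ {i j} → i ≡ 0ℤ ⊎ i ≡ 1ℤ → j ≡ 0ℤ ⊎ j ≡ 1ℤ → i + j + - 1ℤ * 1ℤ ≤ i * j
      bits (inj₁ refl) (inj₁ refl) = ℤ.-≤+
      bits (inj₁ refl) (inj₂ refl) = ℤ.≤-refl
      bits (inj₂ refl) (inj₁ refl) = ℤ.≤-refl
      bits (inj₂ refl) (inj₂ refl) = ℤ.≤-refl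
      total : ∑ (λ z → R x z + R y z + - 1ℤ * 1ℤ) ≡ d x + d y - n
      total = begin
        ∑ (λ z → R x z + R y z + - 1ℤ * 1ℤ)            ≡⟨ ∑-snoc (λ z → R x z + R y z) (- 1ℤ) (λ _ → 1ℤ) ⟩
        ∑ (λ z → R x z + R y z) + - 1ℤ * ∑ {N} (λ _ → 1ℤ) ≡⟨ cong₂ (λ i j → i + - 1ℤ * j) (∑-+ (R x) (R y)) (∑-const N 1ℤ) ⟩
        d x + d y + - 1ℤ * (n * 1ℤ)                      ≡⟨ eq (d x + d y) n ⟩
        d x + d y - n                                    ∎
        where
        open ≡-Reasoning
        eq : ∀ i n → i + - 1ℤ * (n * 1ℤ) ≡ i - n
        eq = solve-∀

    -- Both sides count the walks of length two that start at x.
    ∑c≡s : ∀ x → ∑ (c x) ≡ s x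
    ∑c≡s x = begin
      ∑ (λ y → ∑ λ z → R x z * R y z)  ≡⟨ ∑-swap (λ y z → R x z * R y z) ⟩
      ∑ (λ z → ∑ λ y → R x z * R y z)  ≡⟨ ∑-cong (λ z → ∑-*ˡ (R x z) (λ y → R y z)) ⟩
      ∑ (λ z → R x z * ∑ λ y → R y z)  ≡⟨ ∑-cong (λ z → cong (R x z *_) (∑-cong λ y → R-sym y z)) ⟩
      s x                                  ∎
      where open ≡-Reasoning

    admissible : ∀ x y → Admissible n (d x) (d y) (c x y)
    admissible x y = record
      { 0≤d = 0≤d x ; 0≤D = 0≤d y ; d≤n = d≤n x ; D≤n = d≤n y ; 0≤c = 0≤c x y
      ; c≤d = c≤d x y ; c≤D = subst (_≤ d y) (c-sym y x) (c≤d y x) ; d+D-n≤c = d+d-n≤c x y }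

    -- The common shape of the sums over a second vertex. The terms with `c x y` and with
    -- `R x y * d y` both sum to `s x`, which is what makes the codegree multiplier free.
    ∑-linear : ∀ (a₀ a₁ a₂ a₃ a₄ a₅ : ℤ) x →
      ∑ (λ y → a₀ * 1ℤ + a₁ * d y + a₂ * c x y + a₃ * (R x y * d y) + a₄ * R x y + a₅ * (R x y * c x y))
        ≡ a₀ * n + a₁ * e + a₂ * s x + a₃ * s x + a₄ * d x + a₅ * t x
    ∑-linear a₀ a₁ a₂ a₃ a₄ a₅ x =
      trans (∑-snoc _ a₅ _) (cong (λ i → i + a₅ * t x)
      (trans (∑-snoc _ a₄ _) (cong (λ i → i + a₄ * d x)
      (trans (∑-snoc _ a₃ _) (cong (λ i → i + a₃ * s x)
      (trans (∑-snoc _ a₂ _) (cong₂ (λ i j → i + a₂ * j)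
      (trans (∑-snoc _ a₁ _) (cong (λ i → i + a₁ * e)
      (trans (∑-*ˡ a₀ _) (cong (a₀ *_) (trans (∑-const N 1ℤ) (ℤ.*-identityʳ n)))))) (∑c≡s x))))))))

    α π : Fin N → ℤ
    α x = degreeMultiplier n (d x)
    π x = codegreeMultiplier n (d x)

    -- Each slack is split into two halves so that the half of x can be summed over
    -- y with the multipliers taken at x only.
    slack half : Fin N → Fin N → ℤ
    halfAt : Fin N → (D r k : ℤ) → ℤ
    slack x y = R x y * redSlack n (d x) (d y) (c x y) + (1ℤ - R x y) * blueSlack n (d x) (d y) (c x y)
    half x y = halfAt x (d y) (R x y) (c x y)

    halfAt x D r k =
      (+ 4 * n ^ 7 - + 32 * n ^ 4 * (d x * (n - d x) ^ 2) + d x * α x) * 1ℤ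
      + (+ 32 * n ^ 5 * d x) * D
      + (n ^ 2 * π x - + 32 * n ^ 5 * d x) * k
      + - (n ^ 2 * π x + + 32 * n ^ 5 * d x) * (r * D)
      + - (n * α x) * r
      + (+ 32 * n ^ 5 * d x) * (r * k)

    slack≡halves : ∀ x y → slack x y ≡ half x y + half y x
    slack≡halves x y = trans
      (lemma (R x y) (c x y) (d x) (d y) (d x * (n - d x) ^ 2) (d y * (n - d y) ^ 2)
        (α x) (α y) (π x) (π y) n (n ^ 2) (n ^ 4) (n ^ 5) (n ^ 7))
      (cong₂ (λ r k → half x y + halfAt y (d x) r k) (R-sym x y) (c-sym x y))
      where
      -- The powers of n are unrelated variables, since the identity holds without any relation
      -- among them; this keeps the polynomials of the solver small.
      lemma : ∀ R c d D g g′ α α′ π π′ n n² n⁴ n⁵ n⁷ →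
        R * (+ 8 * n⁷ - + 32 * n⁴ * (g + g′) - n² * (π * (D - c) + π′ * (d - c)) - (n - d) * α - (n - D) * α′)
        + (1ℤ - R) * (+ 8 * n⁷ - + 32 * n⁴ * (g + g′) + + 64 * n⁵ * d * D + d * α + D * α′
           - c * (+ 32 * n⁵ * (d + D) - n² * (π + π′)))
        ≡ (+ 4 * n⁷ - + 32 * n⁴ * g + d * α) * 1ℤ + (+ 32 * n⁵ * d) * D + (n² * π - + 32 * n⁵ * d) * c
          + - (n² * π + + 32 * n⁵ * d) * (R * D) + - (n * α) * R + (+ 32 * n⁵ * d) * (R * c)
        + ((+ 4 * n⁷ - + 32 * n⁴ * g′ + D * α′) * 1ℤ + (+ 32 * n⁵ * D) * d + (n² * π′ - + 32 * n⁵ * D) * c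
          + - (n² * π′ + + 32 * n⁵ * D) * (R * d) + - (n * α′) * R + (+ 32 * n⁵ * D) * (R * c))
      lemma = solve-∀

    -- The multiplier `α x` enters with the factor d x - n R x y, and `π x` with a multiple of c x y
    -- - R x y d y. Both factors sum to zero over y, so the multipliers disappear.
    ∑half : ∀ x → ∑ (half x) ≡ + 4 * (n * n ^ 7) + - (+ 32 * n ^ 5) * (d x * rest x)
    ∑half x = trans
      (∑-linear (+ 4 * n ^ 7 - + 32 * n ^ 4 * (d x * (n - d x) ^ 2) + d x * α x)
        (+ 32 * n ^ 5 * d x) (n ^ 2 * π x - + 32 * n ^ 5 * d x) (- (n ^ 2 * π x + + 32 * n ^ 5 * d x))
        (- (n * α x)) (+ 32 * n ^ 5 * d x) x)
      (lemma (d x) ((n - d x) ^ 2) (α x) (π x) n (n ^ 2) (n ^ 4) (n ^ 7) e (s x) (t x))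
      where
      lemma : ∀ d q α π n n² n⁴ n⁷ e s t →
        (+ 4 * n⁷ - + 32 * n⁴ * (d * q) + d * α) * n + (+ 32 * (n * n⁴) * d) * e
          + (n² * π - + 32 * (n * n⁴) * d) * s + - (n² * π + + 32 * (n * n⁴) * d) * s
          + - (n * α) * d + (+ 32 * (n * n⁴) * d) * t
        ≡ + 4 * (n * n⁷) + - (+ 32 * (n * n⁴)) * (d * (q - (e - + 2 * s + t)))
      lemma = solve-∀

    ∑slack : ∑ (λ x → ∑ (slack x)) ≡ + 8 * n ^ 5 * Δ
    ∑slack = begin
      ∑ (λ x → ∑ (slack x))
        ≡⟨ ∑-cong (λ x → trans (∑-cong (slack≡halves x)) (∑-+ (half x) (λ y → half y x))) ⟩
      ∑ (λ x → ∑ (half x) + ∑ λ y → half y x)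
        ≡⟨ ∑-+ (λ x → ∑ (half x)) (λ x → ∑ λ y → half y x) ⟩
      ∑ (λ x → ∑ (half x)) + ∑ (λ x → ∑ λ y → half y x)
        ≡⟨ cong (λ i → ∑ (λ x → ∑ (half x)) + i) (∑-swap (λ x y → half y x)) ⟩
      ∑ (λ x → ∑ (half x)) + ∑ (λ x → ∑ (half x))
        ≡⟨ cong (λ i → i + i) total ⟩
      (n * (+ 4 * (n * n ^ 7)) + - (+ 32 * n ^ 5) * Λ) + (n * (+ 4 * (n * n ^ 7)) + - (+ 32 * n ^ 5) * Λ)
        ≡⟨ lemma n (n ^ 5) Λ ⟩
      + 8 * n ^ 5 * Δ ∎
      where
      open ≡-Reasoning
      total : ∑ (λ x → ∑ (half x)) ≡ n * (+ 4 * (n * n ^ 7)) + - (+ 32 * n ^ 5) * Λ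
      total = trans (∑-cong ∑half) (trans (∑-snoc (λ _ → + 4 * (n * n ^ 7)) (- (+ 32 * n ^ 5)) (λ x → d x * rest x))
        (cong (λ i → i + - (+ 32 * n ^ 5) * Λ) (∑-const N (+ 4 * (n * n ^ 7)))))
      lemma : ∀ n n⁵ Λ →
        (n * (+ 4 * (n * (n * (n * n⁵)))) + - (+ 32 * n⁵) * Λ) + (n * (+ 4 * (n * (n * (n * n⁵)))) + - (+ 32 * n⁵) * Λ)
        ≡ + 8 * n⁵ * (n * (n * (n * (n * 1ℤ))) - + 8 * Λ)
      lemma = solve-∀

  *-monoˡ : ∀ k {i j} → 0ℤ ≤ k → i ≤ j → k * i ≤ k * j
  *-monoˡ (+ k) {i} {j} _ = ℤ.*-monoˡ-≤-nonNeg (+ k) {i} {j}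

  *-cancelˡ : ∀ k {i j} → 0ℤ < k → k * i ≤ k * j → i ≤ j
  *-cancelˡ k {i} {j} 0<k = ℤ.*-cancelˡ-≤-pos i j k {{ℤ.positive 0<k}}

  *-mono : ∀ {i j k l} → 0ℤ ≤ j → 0ℤ ≤ k → i ≤ j → k ≤ l → i * k ≤ j * l
  *-mono {i} {j} {k} {l} 0≤j 0≤k i≤j k≤l = ℤ.≤-trans {i * k} {j * k}
    (subst₂ _≤_ (ℤ.*-comm k i) (ℤ.*-comm k j) (*-monoˡ k 0≤k i≤j)) (*-monoˡ j 0≤j k≤l)

  weighted-≤ : ∀ r s {i j k l} → 0ℤ ≤ r → 0ℤ ≤ s → i ≤ j → k ≤ l → r * i + s * k ≤ r * j + s * l
  weighted-≤ r s 0≤r 0≤s i≤j k≤l = ℤ.+-mono-≤ (*-monoˡ r 0≤r i≤j) (*-monoˡ s 0≤s k≤l)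

  i≤∣i∣ : ∀ i → i ≤ + ∣ i ∣
  i≤∣i∣ (+ n)      = ℤ.≤-refl
  i≤∣i∣ (-[1+ n ]) = ℤ.-≤+

  -i≤∣i∣ : ∀ i → - i ≤ + ∣ i ∣
  -i≤∣i∣ i = subst (λ k → - i ≤ + k) (ℤ.∣-i∣≡∣i∣ i) (i≤∣i∣ (- i))

  ∣i∣²≡i² : ∀ i → + ∣ i ∣ * + ∣ i ∣ ≡ i * i
  ∣i∣²≡i² (+ n)      = refl
  ∣i∣²≡i² (-[1+ n ]) = refl

  square-cancel-≤ : ∀ {i j} → 0ℤ ≤ j → i * i ≤ j * j → i ≤ j
  square-cancel-≤ {i} {j} 0≤j i²≤j² = ℤ.≮⇒≥ λ j<i → ℤ.≤⇒≯ i²≤j²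
    (ℤ.≤-<-trans {j * j} {j * i} (*-monoˡ j 0≤j (ℤ.<⇒≤ j<i))
      (ℤ.*-monoʳ-<-pos i {{ℤ.positive (ℤ.≤-<-trans 0≤j j<i)}} j<i))

  0<i*j : ∀ {i j} → 0ℤ < i → 0ℤ < j → 0ℤ < i * j
  0<i*j {i} {j} 0<i 0<j = subst (_< i * j) (ℤ.*-zeroʳ i) (ℤ.*-monoˡ-<-pos i {{ℤ.positive 0<i}} 0<j)

  i≤i*i : ∀ {i} → 0ℤ < i → i ≤ i * i
  i≤i*i {i} 0<i = subst (_≤ i * i) (ℤ.*-identityʳ i) (*-monoˡ i (ℤ.<⇒≤ 0<i) (ℤ.i<j⇒suc[i]≤j 0<i))

  -- From a small deficit to degrees near n/2.

  module Bounds {N : ℕ} (R : Fin N → Fin N → ℤ)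
    (R-bit : ∀ x y → R x y ≡ 0ℤ ⊎ R x y ≡ 1ℤ) (R-sym : ∀ x y → R x y ≡ R y x) (0<n : 0ℤ < + N) where

    open Weights R R-bit R-sym

    0≤v² : ∀ x → 0ℤ ≤ v² x
    0≤v² x = 0≤i^2 (excess n (d x))

    v²≤n² : ∀ x → v² x ≤ n * n
    v²≤n² x = ℤ.0≤i-j⇒j≤i (subst (0ℤ ≤_) (lemma n (d x))
      (0≤i*j {+ 4 * d x} {n - d x} (0≤i*j {+ 4} {d x} (+≤+ z≤n) (0≤d x)) (ℤ.i≤j⇒0≤j-i (d≤n x))))
      where
      lemma : ∀ n d → + 4 * d * (n - d) ≡ n * n - (+ 2 * d - n) * ((+ 2 * d - n) * 1ℤ)
      lemma = solve-∀

    0≤1-R : ∀ x y → 0ℤ ≤ 1ℤ - R x y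
    0≤1-R x y = ℤ.i≤j⇒0≤j-i (R≤1 x y)

    gain : Fin N → Fin N → ℤ
    gain x y = R x y * redGain n (d x) (d y) + (1ℤ - R x y) * blueGain n (d x) (d y)

    gain≤slack : ∀ x y → gain x y ≤ slack x y
    gain≤slack x y = weighted-≤ (R x y) (1ℤ - R x y)
      {redGain n (d x) (d y)} {redSlack n (d x) (d y) (c x y)}
      {blueGain n (d x) (d y)} {blueSlack n (d x) (d y) (c x y)} (0≤R x y) (0≤1-R x y)
      (redGain≤redSlack {n} {d x} {d y} {c x y} (admissible x y))
      (blueGain≤blueSlack {n} {d x} {d y} {c x y} (admissible x y))

    ∑gain≤ : ∑ (λ x → ∑ (gain x)) ≤ + 8 * n ^ 5 * Δ
    ∑gain≤ = subst (∑ (λ x → ∑ (gain x)) ≤_) ∑slack (∑-mono λ x → ∑-mono (gain≤slack x))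

    doubleQ : ∑ (λ x → ∑ λ y → (+ 2 * n) * (d x * v² x) * (d y * v² y)) ≡ + 2 * n * Q * Q
    doubleQ = begin
      ∑ (λ x → ∑ λ y → (+ 2 * n) * (d x * v² x) * (d y * v² y))
        ≡⟨ ∑-cong (λ x → ∑-*ˡ ((+ 2 * n) * (d x * v² x)) (λ y → d y * v² y)) ⟩
      ∑ (λ x → (+ 2 * n) * (d x * v² x) * Q)  ≡⟨ ∑-*ʳ Q (λ x → (+ 2 * n) * (d x * v² x)) ⟩
      ∑ (λ x → (+ 2 * n) * (d x * v² x)) * Q  ≡⟨ cong (λ i → i * Q) (∑-*ˡ (+ 2 * n) (λ x → d x * v² x)) ⟩
      + 2 * n * Q * Q                         ∎
      where open ≡-Reasoning

    -- Since d x d y ≤ n², the blue gain dominates the red one. So the red gain may be summed over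
    -- all pairs, where it gives 2nQ².
    Q²-bound : Q * Q ≤ + 4 * n ^ 4 * Δ
    Q²-bound = *-cancelˡ (+ 2 * n) {Q * Q} {+ 4 * n ^ 4 * Δ} 0<2n
      (subst₂ _≤_ (lemma₁ n Q) (lemma₂ n (n ^ 4) Δ) (ℤ.≤-trans
        (subst (_≤ ∑ (λ x → ∑ (gain x))) doubleQ (∑-mono λ x → ∑-mono (λ y → red≤gain x y))) ∑gain≤))
      where
      0<2n : 0ℤ < + 2 * n
      0<2n = subst (_< + 2 * n) (ℤ.*-zeroʳ (+ 2)) (ℤ.*-monoˡ-<-pos (+ 2) 0<n)
      lemma₁ : ∀ n Q → + 2 * n * Q * Q ≡ + 2 * n * (Q * Q)
      lemma₁ = solve-∀
      lemma₂ : ∀ n n⁴ Δ → + 8 * (n * n⁴) * Δ ≡ + 2 * n * (+ 4 * n⁴ * Δ)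
      lemma₂ = solve-∀
      red≤gain : ∀ x y → (+ 2 * n) * (d x * v² x) * (d y * v² y) ≤ gain x y
      red≤gain x y = ℤ.0≤i-j⇒j≤i (subst (0ℤ ≤_) (lemma (R x y) n (d x) (d y) (v² x) (v² y))
        (0≤i*j {1ℤ - R x y} {+ 2 * n * (n * n - d x * d y) * v² x * v² y} (0≤1-R x y)
          (0≤i*j {+ 2 * n * (n * n - d x * d y) * v² x} {v² y} (0≤i*j {+ 2 * n * (n * n - d x * d y)} {v² x}
            (0≤i*j {+ 2 * n} {n * n - d x * d y} (ℤ.<⇒≤ 0<2n)
              (ℤ.i≤j⇒0≤j-i {d x * d y} {n * n} (*-mono {d x} {n} {d y} {n} 0≤n (0≤d y) (d≤n x) (d≤n y))))
            (0≤v² x)) (0≤v² y))))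
        where
        lemma : ∀ R n d D a b → (1ℤ - R) * (+ 2 * n * (n * n - d * D) * a * b) ≡
          R * (+ 2 * n * d * D * a * b) + (1ℤ - R) * (+ 2 * (n * (n * (n * 1ℤ))) * a * b) - + 2 * n * (d * a) * (D * b)
        lemma = solve-∀

    ∑-blue : ∑ (λ x → ∑ λ y → + 2 * n ^ 3 * v² x * v² y + - (+ 2 * n ^ 5 * v² x) * R x y)
      ≡ + 2 * n ^ 3 * Z * Z + - (+ 2 * n ^ 5) * Q
    ∑-blue = begin
      ∑ (λ x → ∑ λ y → + 2 * n ^ 3 * v² x * v² y + - (+ 2 * n ^ 5 * v² x) * R x y)
        ≡⟨ ∑-cong (λ x → trans (∑-snoc (λ y → + 2 * n ^ 3 * v² x * v² y) (- (+ 2 * n ^ 5 * v² x)) (R x))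
             (cong (λ i → i + - (+ 2 * n ^ 5 * v² x) * d x) (∑-*ˡ (+ 2 * n ^ 3 * v² x) v²))) ⟩
      ∑ (λ x → + 2 * n ^ 3 * v² x * Z + - (+ 2 * n ^ 5 * v² x) * d x)
        ≡⟨ ∑-cong (λ x → cong (λ i → + 2 * n ^ 3 * v² x * Z + i) (lemma (+ 2 * n ^ 5) (v² x) (d x))) ⟩
      ∑ (λ x → + 2 * n ^ 3 * v² x * Z + - (+ 2 * n ^ 5) * (d x * v² x))
        ≡⟨ ∑-snoc (λ x → + 2 * n ^ 3 * v² x * Z) (- (+ 2 * n ^ 5)) (λ x → d x * v² x) ⟩
      ∑ (λ x → + 2 * n ^ 3 * v² x * Z) + - (+ 2 * n ^ 5) * Q
        ≡⟨ cong (λ i → i + - (+ 2 * n ^ 5) * Q)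
             (trans (∑-*ʳ Z (λ x → + 2 * n ^ 3 * v² x)) (cong (λ i → i * Z) (∑-*ˡ (+ 2 * n ^ 3) v²))) ⟩
      + 2 * n ^ 3 * Z * Z + - (+ 2 * n ^ 5) * Q ∎
      where
      open ≡-Reasoning
      lemma : ∀ k v d → - (k * v) * d ≡ - k * (d * v)
      lemma = solve-∀

    -- Now the blue gain is summed over all pairs, which gives 2n³Z². On an edge it is at most 2n⁵
    -- v² x, as v² y ≤ n², and these corrections sum to 2n⁵Q.
    Z²-bound : Z * Z ≤ n ^ 2 * (+ 4 * Δ + Q)
    Z²-bound = *-cancelˡ (+ 2 * n ^ 3) {Z * Z} {n ^ 2 * (+ 4 * Δ + Q)} 0<2n³
      (ℤ.0≤i-j⇒j≤i (subst (0ℤ ≤_) (lemma n (n ^ 3) Δ Q Z) (ℤ.i≤j⇒0≤j-i (ℤ.≤-trans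
        (subst (_≤ ∑ (λ x → ∑ (gain x))) ∑-blue (∑-mono λ x → ∑-mono (λ y → blue≤gain x y))) ∑gain≤))))
      where
      0<2n³ : 0ℤ < + 2 * n ^ 3
      0<2n³ = 0<i*j {+ 2} {n ^ 3} (+<+ (ℕ.s≤s z≤n)) (0<i*j 0<n (0<i*j 0<n (0<i*j 0<n (+<+ (ℕ.s≤s z≤n)))))
      lemma : ∀ n n³ Δ Q Z → + 8 * (n * (n * n³)) * Δ - (+ 2 * n³ * Z * Z + - (+ 2 * (n * (n * n³))) * Q)
        ≡ + 2 * n³ * (n * (n * 1ℤ) * (+ 4 * Δ + Q)) - + 2 * n³ * (Z * Z)
      lemma = solve-∀
      blue≤gain : ∀ x y → + 2 * n ^ 3 * v² x * v² y + - (+ 2 * n ^ 5 * v² x) * R x y ≤ gain x y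
      blue≤gain x y = ℤ.0≤i-j⇒j≤i (subst (0ℤ ≤_) (lemma′ (R x y) n (n ^ 3) (d x) (d y) (v² x) (v² y))
        (0≤i*j {R x y} {+ 2 * n * d x * d y * v² x * v² y + + 2 * n ^ 3 * v² x * (n * n - v² y)} (0≤R x y)
          (0≤i+j {+ 2 * n * d x * d y * v² x * v² y} {+ 2 * n ^ 3 * v² x * (n * n - v² y)}
            (0≤i*j {+ 2 * n * d x * d y * v² x} {v² y} (0≤i*j {+ 2 * n * d x * d y} {v² x}
              (0≤i*j {+ 2 * n * d x} {d y} (0≤i*j {+ 2 * n} {d x} (0≤i*j {+ 2} {n} (+≤+ z≤n) 0≤n) (0≤d x)) (0≤d y))
              (0≤v² x)) (0≤v² y))
            (0≤i*j {+ 2 * n ^ 3 * v² x} {n * n - v² y} (0≤i*j {+ 2 * n ^ 3} {v² x} (ℤ.<⇒≤ 0<2n³) (0≤v² x))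
              (ℤ.i≤j⇒0≤j-i (v²≤n² y))))))
        where
        lemma′ : ∀ R n n³ d D a b → R * (+ 2 * n * d * D * a * b + + 2 * n³ * a * (n * n - b)) ≡
          R * (+ 2 * n * d * D * a * b) + (1ℤ - R) * (+ 2 * n³ * a * b)
            - (+ 2 * n³ * a * b + - (+ 2 * (n * (n * n³)) * a) * R)
        lemma′ = solve-∀

  -- Triples with an odd number of edges, and the choice of constants.

  module Stability {N : ℕ} (R : Fin N → Fin N → ℤ)
    (R-bit : ∀ x y → R x y ≡ 0ℤ ⊎ R x y ≡ 1ℤ) (R-sym : ∀ x y → R x y ≡ R y x) (0<n : 0ℤ < + N) where

    open Weights R R-bit R-sym
    open Bounds R R-bit R-sym 0<n

    -- Compare G with the complete bipartite graph between the neighbourhood of x and its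
    -- complement. In ordered pairs, `t x` and `r x` count the edges inside the two sides; `ρ x`
    -- counts the missing pairs across, in one order. The last term of `bad` pays for making the
    -- sides balanced.
    r a V ρ bad : Fin N → ℤ
    r x = e - + 2 * s x + t x
    V x = + 2 * d x - n
    a x = + ∣ V x ∣
    ρ x = d x * (n - d x) - s x + t x
    bad x = t x + r x + + 2 * ρ x + n * (a x + 1ℤ)

    S : ℤ
    S = ∑ a

    0≤t : ∀ x → 0ℤ ≤ t x
    0≤t x = ∑-nonneg λ y → 0≤i*j (0≤R x y) (0≤c x y)

    -- The factor d y - c x y counts the neighbours of y outside the neighbourhood of x.
    r-sum : ∀ x → ∑ (λ y → (1ℤ - R x y) * (d y - c x y)) ≡ r x
    r-sum x = trans (∑-cong λ y → lemma (R x y) (d y) (c x y)) (trans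
      (∑-linear 0ℤ 1ℤ (- 1ℤ) (- 1ℤ) 0ℤ 1ℤ x) (lemma′ n e (s x) (d x) (t x)))
      where
      lemma : ∀ R D c → (1ℤ - R) * (D - c) ≡ 0ℤ * 1ℤ + 1ℤ * D + - 1ℤ * c + - 1ℤ * (R * D) + 0ℤ * R + 1ℤ * (R * c)
      lemma = solve-∀
      lemma′ : ∀ n e s d t → 0ℤ * n + 1ℤ * e + - 1ℤ * s + - 1ℤ * s + 0ℤ * d + 1ℤ * t ≡ e - + 2 * s + t
      lemma′ = solve-∀

    0≤D-c : ∀ x y → 0ℤ ≤ d y - c x y
    0≤D-c x y = ℤ.i≤j⇒0≤j-i (subst (_≤ d y) (c-sym y x) (c≤d y x))

    0≤r : ∀ x → 0ℤ ≤ r x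
    0≤r x = subst (0ℤ ≤_) (r-sum x) (∑-nonneg λ y → 0≤i*j {1ℤ - R x y} {d y - c x y} (0≤1-R x y) (0≤D-c x y))

    r≤n² : ∀ x → r x ≤ n * n
    r≤n² x = subst₂ _≤_ (r-sum x) (∑-const N n) (∑-mono λ y →
      subst ((1ℤ - R x y) * (d y - c x y) ≤_) (ℤ.*-identityˡ n)
        (*-mono {1ℤ - R x y} {1ℤ} {d y - c x y} {n} (+≤+ z≤n) (0≤D-c x y) (1-R≤1 x y) (D-c≤n x y)))
      where
      i-j≤i : ∀ i j → 0ℤ ≤ j → i - j ≤ i
      i-j≤i i j 0≤j = subst (i - j ≤_) (ℤ.+-identityʳ i) (ℤ.+-monoʳ-≤ i (ℤ.neg-mono-≤ 0≤j))
      1-R≤1 : ∀ x y → 1ℤ - R x y ≤ 1ℤ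
      1-R≤1 x y = i-j≤i 1ℤ (R x y) (0≤R x y)
      D-c≤n : ∀ x y → d y - c x y ≤ n
      D-c≤n x y = ℤ.≤-trans (i-j≤i (d y) (c x y) (0≤c x y)) (d≤n y)

    ∑s≡∑d² : ∑ s ≡ ∑ (λ x → d x * d x)
    ∑s≡∑d² = begin
      ∑ (λ x → ∑ λ y → R x y * d y)  ≡⟨ ∑-swap (λ x y → R x y * d y) ⟩
      ∑ (λ y → ∑ λ x → R x y * d y)  ≡⟨ ∑-cong (λ y → ∑-*ʳ (d y) (λ x → R x y)) ⟩
      ∑ (λ y → ∑ (λ x → R x y) * d y) ≡⟨ ∑-cong (λ y → cong (λ i → i * d y) (∑-cong λ x → R-sym x y)) ⟩
      ∑ (λ y → d y * d y)            ∎
      where open ≡-Reasoning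

    -- From ∑ d = e and ∑ s = ∑ d². Such terms of zero sum turn identities between sums into
    -- pointwise ones, which the ring solver can check.
    ∑correction : ∀ k l → ∑ (λ x → k * (e + - n * d x) + l * (d x * d x + - 1ℤ * s x)) ≡ 0ℤ
    ∑correction k l = begin
      ∑ (λ x → k * (e + - n * d x) + l * (d x * d x + - 1ℤ * s x))
        ≡⟨ ∑-snoc (λ x → k * (e + - n * d x)) l (λ x → d x * d x + - 1ℤ * s x) ⟩
      ∑ (λ x → k * (e + - n * d x)) + l * ∑ (λ x → d x * d x + - 1ℤ * s x)
        ≡⟨ cong₂ (λ i j → i + l * j) (∑-*ˡ k (λ x → e + - n * d x)) (∑-snoc (λ x → d x * d x) (- 1ℤ) s) ⟩
      k * ∑ (λ x → e + - n * d x) + l * (∑ (λ x → d x * d x) + - 1ℤ * ∑ s)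
        ≡⟨ cong₂ (λ i j → k * i + l * (∑ (λ x → d x * d x) + - 1ℤ * j))
             (trans (∑-snoc (λ _ → e) (- n) d) (cong (λ i → i + - n * e) (∑-const N e))) ∑s≡∑d² ⟩
      k * (n * e + - n * e) + l * (∑ (λ x → d x * d x) + - 1ℤ * ∑ (λ x → d x * d x))
        ≡⟨ lemma k l n e (∑ (λ x → d x * d x)) ⟩
      0ℤ ∎
      where
      open ≡-Reasoning
      lemma : ∀ k l n e q → k * (n * e + - n * e) + l * (q + - 1ℤ * q) ≡ 0ℤ
      lemma = solve-∀

    ∑-corrected : ∀ {f g : Fin N → ℤ} k l →
      (∀ x → f x + (k * (e + - n * d x) + l * (d x * d x + - 1ℤ * s x)) ≡ g x) → ∑ f ≡ ∑ g
    ∑-corrected {f} {g} k l f+correction≡g = begin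
      ∑ f                                                ≡⟨ sym (ℤ.+-identityʳ (∑ f)) ⟩
      ∑ f + 0ℤ                                           ≡⟨ cong (λ i → ∑ f + i) (sym (∑correction k l)) ⟩
      ∑ f + ∑ (λ x → k * (e + - n * d x) + l * (d x * d x + - 1ℤ * s x))
        ≡⟨ sym (∑-+ f (λ x → k * (e + - n * d x) + l * (d x * d x + - 1ℤ * s x))) ⟩
      ∑ (λ x → f x + (k * (e + - n * d x) + l * (d x * d x + - 1ℤ * s x)))  ≡⟨ ∑-cong f+correction≡g ⟩
      ∑ g                                                ∎
      where open ≡-Reasoning

    -- In a graph, the sum of r + t counts the triples spanning one or three edges, with
    -- multiplicity. On the right everything but the deficit has a factor `V x`, so it is small once
    -- the degrees are near n/2.
    ∑odd-identity : ∑ (λ x → + 2 * n * (r x + t x)) ≡ Δ + ∑ (λ x → V x * (V x * V x) + - (+ 4) * (V x * r x))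
    ∑odd-identity = trans
      (∑-corrected {λ x → + 2 * n * (r x + t x)} (+ 2 * n) (+ 4 * n) (λ x → lemma n e (d x) (s x) (t x)))
      (trans (∑-+ (λ x → n * (n * (n * 1ℤ)) + - (+ 8) * (d x * rest x)) (λ x → V x * (V x * V x) + - (+ 4) * (V x * r x)))
        (cong (λ i → i + ∑ (λ x → V x * (V x * V x) + - (+ 4) * (V x * r x)))
          (trans (∑-snoc (λ _ → n * (n * (n * 1ℤ))) (- (+ 8)) (λ x → d x * rest x))
            (trans (cong (λ i → i + - (+ 8) * Λ) (∑-const N (n * (n * (n * 1ℤ))))) (lemma′ n Λ)))))
      where
      lemma : ∀ n e d s t →
        + 2 * n * ((e - + 2 * s + t) + t) + (+ 2 * n * (e + - n * d) + + 4 * n * (d * d + - 1ℤ * s)) ≡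
        n * (n * (n * 1ℤ)) + - (+ 8) * (d * ((n - d) * ((n - d) * 1ℤ) - (e - + 2 * s + t)))
        + ((+ 2 * d - n) * ((+ 2 * d - n) * (+ 2 * d - n)) + - (+ 4) * ((+ 2 * d - n) * (e - + 2 * s + t)))
      lemma = solve-∀
      lemma′ : ∀ n Λ → n * (n * (n * (n * 1ℤ))) + - (+ 8) * Λ ≡ n * (n * (n * (n * 1ℤ))) - + 8 * Λ
      lemma′ = solve-∀

    a² : ∀ x → a x * a x ≡ V x * V x
    a² x = ∣i∣²≡i² (V x)

    V²≤n² : ∀ x → V x * V x ≤ n * n
    V²≤n² x = subst (_≤ n * n) (cong (λ i → V x * i) (ℤ.*-identityʳ (V x))) (v²≤n² x)

    0≤a : ∀ x → 0ℤ ≤ a x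
    0≤a x = +≤+ z≤n

    ∑odd≤ : ∑ (λ x → + 2 * n * (r x + t x)) ≤ Δ + + 5 * (n * n) * S
    ∑odd≤ = subst (_≤ Δ + + 5 * (n * n) * S) (sym ∑odd-identity) (ℤ.+-monoʳ-≤ Δ
      (subst (∑ (λ x → V x * (V x * V x) + - (+ 4) * (V x * r x)) ≤_) (∑-*ˡ (+ 5 * (n * n)) a) (∑-mono bound)))
      where
      bound : ∀ x → V x * (V x * V x) + - (+ 4) * (V x * r x) ≤ + 5 * (n * n) * a x
      bound x = subst₂ _≤_ (lemma (V x) (r x)) (lemma′ (n * n) (a x)) (ℤ.+-mono-≤
        (*-mono {V x} {a x} {V x * V x} {n * n} (0≤a x)
          (subst (0ℤ ≤_) (a² x) (0≤i*j (0≤a x) (0≤a x))) (i≤∣i∣ (V x)) (V²≤n² x))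
        (*-monoˡ (+ 4) (+≤+ z≤n) (*-mono { - V x} {a x} {r x} {n * n} (0≤a x) (0≤r x) (-i≤∣i∣ (V x)) (r≤n² x))))
        where
        lemma : ∀ V r → V * (V * V) + + 4 * (- V * r) ≡ V * (V * V) + - (+ 4) * (V * r)
        lemma = solve-∀
        lemma′ : ∀ m a → a * m + + 4 * (a * m) ≡ + 5 * m * a
        lemma′ = solve-∀

    -- In a graph, `ρ` and `r` have the same sum, as both count the triples with exactly one edge.
    -- So `bad` may be replaced by t + 3r ≤ 3 (r + t) plus its last term; 17 is 3 · 5 from `∑odd≤`
    -- and 2 from that term.
    ∑bad≤ : + 2 * n * ∑ bad ≤ + 3 * Δ + + 17 * (n * n) * S + + 2 * n * (n * n)
    ∑bad≤ = ℤ.≤-trans (subst (_≤ ∑ (λ x → + 3 * (+ 2 * n * (r x + t x)) + (+ 2 * n * n) * (a x + 1ℤ)))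
        (trans (sym ∑bad) (∑-*ˡ (+ 2 * n) bad)) (∑-mono bound))
      (subst₂ _≤_ (sym right) (lemma″ Δ n S) (ℤ.+-monoˡ-≤ (+ 2 * n * n * (S + n))
        (*-monoˡ (+ 3) (+≤+ z≤n) ∑odd≤)))
      where
      f : Fin N → ℤ
      f x = + 2 * n * (t x + + 3 * r x) + + 2 * n * n * (a x + 1ℤ) + - (+ 4 * n) * 0ℤ
      ∑bad : ∑ (λ x → + 2 * n * bad x) ≡ ∑ f
      ∑bad = ∑-corrected {λ x → + 2 * n * bad x} (+ 4 * n) (+ 4 * n) (λ x → lemma n e (d x) (s x) (t x) (a x))
        where
        lemma : ∀ n e d s t a →
          + 2 * n * (t + (e - + 2 * s + t) + + 2 * (d * (n - d) - s + t) + n * (a + 1ℤ))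
            + (+ 4 * n * (e + - n * d) + + 4 * n * (d * d + - 1ℤ * s))
          ≡ + 2 * n * (t + + 3 * (e - + 2 * s + t)) + + 2 * n * n * (a + 1ℤ) + - (+ 4 * n) * 0ℤ
        lemma = solve-∀
      bound : ∀ x → f x ≤ + 3 * (+ 2 * n * (r x + t x)) + (+ 2 * n * n) * (a x + 1ℤ)
      bound x = ℤ.0≤i-j⇒j≤i (subst (0ℤ ≤_) (lemma n (r x) (t x) (a x))
        (0≤i*j {+ 4 * n} {t x} (0≤i*j {+ 4} {n} (+≤+ z≤n) 0≤n) (0≤t x)))
        where
        lemma : ∀ n r t a → + 4 * n * t ≡ + 3 * (+ 2 * n * (r + t)) + (+ 2 * n * n) * (a + 1ℤ)
          - (+ 2 * n * (t + + 3 * r) + + 2 * n * n * (a + 1ℤ) + - (+ 4 * n) * 0ℤ)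
        lemma = solve-∀
      right : ∑ (λ x → + 3 * (+ 2 * n * (r x + t x)) + (+ 2 * n * n) * (a x + 1ℤ))
        ≡ + 3 * ∑ (λ x → + 2 * n * (r x + t x)) + + 2 * n * n * (S + n)
      right = trans (∑-snoc (λ x → + 3 * (+ 2 * n * (r x + t x))) (+ 2 * n * n) (λ x → a x + 1ℤ))
        (cong₂ (λ i j → i + + 2 * n * n * j) (∑-*ˡ (+ 3) (λ x → + 2 * n * (r x + t x)))
          (trans (∑-+ a (λ _ → 1ℤ)) (cong (λ i → S + i) (trans (∑-const N 1ℤ) (ℤ.*-identityʳ n)))))
      lemma″ : ∀ Δ n S → + 3 * (Δ + + 5 * (n * n) * S) + + 2 * n * n * (S + n) ≡
        + 3 * Δ + + 17 * (n * n) * S + + 2 * n * (n * n)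
      lemma″ = solve-∀

    -- A linearised Cauchy-Schwarz inequality: n K a ≤ n² + K² a² at each vertex, with K free to
    -- balance the two terms.
    S-bound : ∀ K → 0ℤ ≤ K → n * K * S ≤ n * (n * n) + K * K * Z
    S-bound K 0≤K = subst₂ _≤_ (∑-*ˡ (n * K) a)
      (trans (∑-snoc (λ _ → n * n) (K * K) v²) (cong (λ i → i + K * K * Z) (∑-const N (n * n))))
      (∑-mono bound)
      where
      bound : ∀ x → n * K * a x ≤ n * n + K * K * v² x
      bound x = ℤ.0≤i-j⇒j≤i (subst (0ℤ ≤_) (trans (lemma n K (a x)) (cong (λ i → n * n + K * K * i - n * K * a x)
          (trans (a² x) (cong (λ i → V x * i) (sym (ℤ.*-identityʳ (V x)))))))
        (0≤i+j {(n - K * a x) * (n - K * a x)} {n * K * a x} (0≤i*i (n - K * a x))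
          (0≤i*j {n * K} {a x} (0≤i*j {n} {K} 0≤n 0≤K) (0≤a x))))
        where
        lemma : ∀ n K a → (n - K * a) * (n - K * a) + n * K * a ≡ n * n + K * K * (a * a) - n * K * a
        lemma = solve-∀

    -- The extremal bound Λ ≤ n⁴/8 itself: a negative deficit would contradict Q² ≥ 0.
    0≤Δ : 0ℤ ≤ Δ
    0≤Δ = *-cancelˡ (+ 4 * n ^ 4) {0ℤ} {Δ} 0<4n⁴
      (subst (_≤ + 4 * n ^ 4 * Δ) (sym (ℤ.*-zeroʳ (+ 4 * n ^ 4))) (ℤ.≤-trans (0≤i*i Q) Q²-bound))
      where
      0<4n⁴ : 0ℤ < + 4 * n ^ 4
      0<4n⁴ = 0<i*j {+ 4} {n ^ 4} (+<+ (ℕ.s≤s z≤n))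
        (0<i*j 0<n (0<i*j 0<n (0<i*j 0<n (0<i*j 0<n (+<+ (ℕ.s≤s z≤n))))))

    -- 34 is twice the coefficient of n²S in ∑bad≤.
    module Conclusion (J E : ℤ) (0<J : 0ℤ < J) where

      K K² K⁴ K⁸ : ℤ
      K  = + 34 * J
      K² = K * K
      K⁴ = K² * K²
      K⁸ = K⁴ * K⁴

      0<K : 0ℤ < K
      0<K = 0<i*j {+ 34} {J} (+<+ (ℕ.s≤s z≤n)) 0<J

      0<K² : 0ℤ < K²
      0<K² = 0<i*j 0<K 0<K

      0<K⁴ : 0ℤ < K⁴
      0<K⁴ = 0<i*j 0<K² 0<K²

      0≤K⁸ : 0ℤ ≤ K⁸
      0≤K⁸ = 0≤i*i K⁴

      0≤n^ : ∀ k → 0ℤ ≤ n ^ k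
      0≤n^ zero    = +≤+ z≤n
      0≤n^ (suc k) = 0≤i*j {n} {n ^ k} 0≤n (0≤n^ k)

      J≤K⁴ : J ≤ K⁴
      J≤K⁴ = ℤ.≤-trans {J} {K} (subst (_≤ K) (ℤ.*-identityˡ J)
          (*-mono {1ℤ} {+ 34} {J} {J} (+≤+ z≤n) (ℤ.<⇒≤ 0<J) (+≤+ (ℕ.s≤s z≤n)) ℤ.≤-refl))
        (ℤ.≤-trans {K} {K²} (i≤i*i 0<K) (i≤i*i 0<K²))

      -- The bounds on `Q`, `Z` and `S` each cost a square root: relative to their trivial sizes, Δ,
      -- Q, Z and S have orders K⁻⁸, K⁻⁴, K⁻² and K⁻¹. Hence the eighth power.
      module _ (16K⁸Δ≤n⁴ : + 16 * K⁸ * Δ ≤ n ^ 4) (4J≤n : + 4 * J ≤ n) (E≤bad : ∀ x → E ≤ bad x) where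

        2K⁴Q≤n⁴ : + 2 * K⁴ * Q ≤ n ^ 4
        2K⁴Q≤n⁴ = square-cancel-≤ {+ 2 * K⁴ * Q} {n ^ 4} (0≤n^ 4) (subst₂ _≤_ (lemma K⁴ Q) refl (ℤ.≤-trans
            (*-monoˡ (+ 4 * K⁸) (0≤i*j {+ 4} {K⁸} (+≤+ z≤n) 0≤K⁸) Q²-bound)
            (subst (_≤ n ^ 4 * n ^ 4) (lemma′ K⁸ (n ^ 4) Δ) (*-monoˡ (n ^ 4) (0≤n^ 4) 16K⁸Δ≤n⁴))))
          where
          lemma : ∀ k q → + 4 * (k * k) * (q * q) ≡ + 2 * k * q * (+ 2 * k * q)
          lemma = solve-∀
          lemma′ : ∀ k n⁴ Δ → n⁴ * (+ 16 * k * Δ) ≡ + 4 * k * (+ 4 * n⁴ * Δ)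
          lemma′ = solve-∀

        8K⁴Δ≤n⁴ : + 8 * K⁴ * Δ ≤ n ^ 4
        8K⁴Δ≤n⁴ = ℤ.≤-trans (ℤ.0≤i-j⇒j≤i (subst (0ℤ ≤_) (lemma K⁴ Δ)
            (0≤i+j {+ 8 * K⁸ * Δ} {+ 8 * (K⁸ - K⁴) * Δ} (0≤i*j {+ 8 * K⁸} {Δ} (0≤i*j {+ 8} {K⁸} (+≤+ z≤n) 0≤K⁸) 0≤Δ)
              (0≤i*j {+ 8 * (K⁸ - K⁴)} {Δ} (0≤i*j {+ 8} {K⁸ - K⁴} (+≤+ z≤n) (ℤ.i≤j⇒0≤j-i (i≤i*i 0<K⁴))) 0≤Δ))))
          16K⁸Δ≤n⁴
          where
          lemma : ∀ k Δ → + 8 * (k * k) * Δ + + 8 * (k * k - k) * Δ ≡ + 16 * (k * k) * Δ - + 8 * k * Δ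
          lemma = solve-∀

        K²Z≤n³ : K² * Z ≤ n ^ 3
        K²Z≤n³ = square-cancel-≤ {K² * Z} {n ^ 3} (0≤n^ 3) (subst₂ _≤_ (lemma K² Z) (lemma″ n) (ℤ.≤-trans
            (*-monoˡ K⁴ (ℤ.<⇒≤ 0<K⁴) Z²-bound)
            (subst (_≤ n ^ 2 * n ^ 4) (lemma′ K⁴ (n ^ 2) Δ Q) (*-monoˡ (n ^ 2) (0≤n^ 2)
              (*-cancelˡ (+ 2) {K⁴ * (+ 4 * Δ + Q)} {n ^ 4} (+<+ (ℕ.s≤s z≤n))
                (subst₂ _≤_ (lemma‴ K⁴ Δ Q) (lemma⁗ (n ^ 4)) (ℤ.+-mono-≤ 8K⁴Δ≤n⁴ 2K⁴Q≤n⁴)))))))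
          where
          lemma : ∀ k z → k * k * (z * z) ≡ k * z * (k * z)
          lemma = solve-∀
          lemma′ : ∀ k n² Δ Q → n² * (k * (+ 4 * Δ + Q)) ≡ k * (n² * (+ 4 * Δ + Q))
          lemma′ = solve-∀
          lemma″ : ∀ n → (n * (n * 1ℤ)) * (n * (n * (n * (n * 1ℤ)))) ≡ (n * (n * (n * 1ℤ))) * (n * (n * (n * 1ℤ)))
          lemma″ = solve-∀
          lemma‴ : ∀ k Δ Q → + 8 * k * Δ + + 2 * k * Q ≡ + 2 * (k * (+ 4 * Δ + Q))
          lemma‴ = solve-∀
          lemma⁗ : ∀ m → m + m ≡ + 2 * m
          lemma⁗ = solve-∀

        KS≤2n² : K * S ≤ + 2 * (n * n)
        KS≤2n² = *-cancelˡ n {K * S} {+ 2 * (n * n)} 0<n (subst₂ _≤_ (ℤ.*-assoc n K S) (lemma n)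
          (ℤ.≤-trans (S-bound K (ℤ.<⇒≤ 0<K)) (ℤ.+-monoʳ-≤ (n * (n * n)) K²Z≤n³)))
          where
          lemma : ∀ n → n * (n * n) + n * (n * (n * 1ℤ)) ≡ n * (+ 2 * (n * n))
          lemma = solve-∀

        6JΔ≤n⁴ : + 6 * J * Δ ≤ n ^ 4
        6JΔ≤n⁴ = ℤ.≤-trans (*-mono {+ 6 * J} {+ 8 * K⁴} {Δ} {Δ} (0≤i*j {+ 8} {K⁴} (+≤+ z≤n) (ℤ.<⇒≤ 0<K⁴)) 0≤Δ
          (*-mono {+ 6} {+ 8} {J} {K⁴} (+≤+ z≤n) (ℤ.<⇒≤ 0<J) (+≤+ (ℕ.m≤m+n 6 2)) J≤K⁴)
          ℤ.≤-refl) 8K⁴Δ≤n⁴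

        -- No good vertex is selected: E is at most every `bad x`, hence at most their mean.
        2nnE≤ : + 2 * n * (n * E) ≤ + 3 * Δ + + 17 * (n * n) * S + + 2 * n * (n * n)
        2nnE≤ = ℤ.≤-trans (*-monoˡ (+ 2 * n) (0≤i*j {+ 2} {n} (+≤+ z≤n) 0≤n)
          (subst (_≤ ∑ bad) (∑-const N E) (∑-mono E≤bad))) ∑bad≤

        J*E≤n² : J * E ≤ n * n
        J*E≤n² = *-cancelˡ (+ 4 * (n * n)) {J * E} {n * n} (0<i*j {+ 4} {n * n} (+<+ (ℕ.s≤s z≤n)) (0<i*j 0<n 0<n))
          (ℤ.≤-trans
            (subst₂ _≤_ (lemma n J E) (lemma′ n J Δ S) (*-monoˡ (+ 2 * J) (0≤i*j {+ 2} {J} (+≤+ z≤n) (ℤ.<⇒≤ 0<J)) 2nnE≤))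
            -- After multiplication by 2J the three terms are at most n⁴, 2n⁴ and n⁴. The second
            -- uses K = 34J, the third, from rounding n/2, uses 4J ≤ n.
            (subst (+ 6 * J * Δ + n * n * (+ 34 * J * S) + n * (n * n) * (+ 4 * J) ≤_) (lemma″ n)
              (ℤ.+-mono-≤ (ℤ.+-mono-≤ 6JΔ≤n⁴
              (*-monoˡ (n * n) (0≤i*i n) KS≤2n²)) (*-monoˡ (n * (n * n)) (0≤i*j {n} {n * n} 0≤n (0≤i*i n)) 4J≤n))))
          where
          lemma : ∀ n J E → + 2 * J * (+ 2 * n * (n * E)) ≡ + 4 * (n * n) * (J * E)
          lemma = solve-∀
          lemma′ : ∀ n J Δ S → + 2 * J * (+ 3 * Δ + + 17 * (n * n) * S + + 2 * n * (n * n)) ≡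
            + 6 * J * Δ + n * n * (+ 34 * J * S) + n * (n * n) * (+ 4 * J)
          lemma′ = solve-∀
          lemma″ : ∀ n → n * (n * (n * (n * 1ℤ))) + n * n * (+ 2 * (n * n)) + n * (n * n) * n ≡ + 4 * (n * n) * (n * n)
          lemma″ = solve-∀

  -- Embeddings counted by products of indicators.

  indicator : ∀ {a} {A : Set a} → Dec A → ℤ
  indicator a? = if does a? then 1ℤ else 0ℤ

  indicator-bit : ∀ {a} {A : Set a} (a? : Dec A) → indicator a? ≡ 0ℤ ⊎ indicator a? ≡ 1ℤ
  indicator-bit (yes _) = inj₂ refl
  indicator-bit (no _)  = inj₁ refl

  indicator-yes : ∀ {a} {A : Set a} (a? : Dec A) → A → indicator a? ≡ 1ℤ
  indicator-yes (yes _) _ = refl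
  indicator-yes (no ¬a) a = contradiction a ¬a

  indicator-no : ∀ {a} {A : Set a} (a? : Dec A) → ¬ A → indicator a? ≡ 0ℤ
  indicator-no (yes a) ¬a = contradiction a ¬a
  indicator-no (no _)  _  = refl

  indicator-cong : ∀ {a b} {A : Set a} {B : Set b} (a? : Dec A) (b? : Dec B) →
    (A → B) → (B → A) → indicator a? ≡ indicator b?
  indicator-cong (yes a) b? f g = sym (indicator-yes b? (f a))
  indicator-cong (no ¬a) b? f g = sym (indicator-no b? (¬a ∘ g))

  total : ∀ {A : Set} → (A → ℤ) → List A → ℤ
  total g = foldr (λ x i → g x + i) 0ℤ

  length-filter-≤ : ∀ {A : Set} {P : Pred A 0ℓ} (P? : Decidable P) {g : A → ℤ} →
    (∀ x → indicator (P? x) ≤ g x) → ∀ xs → + length (filter P? xs) ≤ total g xs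
  length-filter-≤ P? g≥ [] = ℤ.≤-refl
  length-filter-≤ P? {g} g≥ (x ∷ xs) with does (P? x) | g≥ x
  ... | true  | 1≤gx = ℤ.+-mono-≤ 1≤gx (length-filter-≤ P? g≥ xs)
  ... | false | 0≤gx = subst (_≤ g x + total g xs) (ℤ.+-identityˡ _) (ℤ.+-mono-≤ 0≤gx (length-filter-≤ P? g≥ xs))

  total-++ : ∀ {A : Set} (g : A → ℤ) xs ys → total g (xs ++ ys) ≡ total g xs + total g ys
  total-++ g []       ys = sym (ℤ.+-identityˡ (total g ys))
  total-++ g (x ∷ xs) ys = trans (cong (λ i → g x + i) (total-++ g xs ys)) (sym (ℤ.+-assoc (g x) (total g xs) (total g ys)))

  total-map : ∀ {A B : Set} (g : B → ℤ) (f : A → B) xs → total g (map f xs) ≡ total (λ x → g (f x)) xs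
  total-map g f []       = refl
  total-map g f (x ∷ xs) = cong (λ i → g (f x) + i) (total-map g f xs)

  total-product : ∀ {A B C : Set} (g : C → ℤ) (f : A → B → C) {n} (h : Fin n → A) ys →
    total g (cartesianProductWith f (tabulate h) ys) ≡ ∑ λ i → total (λ y → g (f (h i) y)) ys
  total-product g f {zero}  h ys = sym (∑-empty (λ i → total (λ y → g (f (h i) y)) ys))
  total-product g f {suc n} h ys = trans (total-++ g (map (f (h zero)) ys) (cartesianProductWith f (tabulate (h ∘ suc)) ys))
    (trans (cong₂ _+_ (total-map g (f (h zero)) ys) (total-product g f (h ∘ suc) ys))
      (sym (∑-suc (λ i → total (λ y → g (f (h i) y)) ys))))

  total-functions : ∀ k n (g : (Fin (suc k) → Fin n) → ℤ) →
    total g (functions (suc k) n) ≡ ∑ λ x → total (λ f → g (x Vector.∷ f)) (functions k n)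
  total-functions k n g = total-product g Vector._∷_ id (functions k n)

  module Counts {N : ℕ} (G : Graph N) where
    open Graph G using (Adj; Adj?)

    R : Fin N → Fin N → ℤ
    R x y = indicator (Adj? x y)

    R-bit : ∀ x y → R x y ≡ 0ℤ ⊎ R x y ≡ 1ℤ
    R-bit x y = indicator-bit (Adj? x y)

    R-sym : ∀ x y → R x y ≡ R y x
    R-sym x y = indicator-cong (Adj? x y) (Adj? y x) (Graph.sym G) (Graph.sym G)

    open Weights R R-bit R-sym

    weight : (x₀ x₁ x₂ x₃ : Fin N) → ℤ
    weight x₀ x₁ x₂ x₃ = ((1ℤ - R x₀ x₁) * R x₀ x₂) * ((1ℤ - R x₀ x₃) * (1ℤ - R x₁ x₃))

    0≤1-bit : ∀ {i} → i ≡ 0ℤ ⊎ i ≡ 1ℤ → 0ℤ ≤ 1ℤ - i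
    0≤1-bit (inj₁ refl) = +≤+ z≤n
    0≤1-bit (inj₂ refl) = +≤+ z≤n

    -- The weight also counts maps that are not injective, such as those with x₁ = x₃. An upper
    -- bound is the right direction: many embeddings then force a small deficit.
    embedding-≤ : ∀ f → indicator (isEmbedding? H G f) ≤ weight (f 0F) (f 1F) (f 2F) (f 3F)
    embedding-≤ f = bound (isEmbedding? H G f)
      where
      bound : (e? : Dec (IsEmbedding H G f)) → indicator e? ≤ weight (f 0F) (f 1F) (f 2F) (f 3F)
      bound (no _) = 0≤i*j (0≤i*j (0≤1-bit (R-bit (f 0F) (f 1F))) (0≤R (f 0F) (f 2F)))
        (0≤i*j (0≤1-bit (R-bit (f 0F) (f 3F))) (0≤1-bit (R-bit (f 1F) (f 3F))))
      bound (yes (_ , onRed , onBlue))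
        rewrite indicator-yes (Adj? (f 0F) (f 2F)) (onRed 0F 2F refl)
              | indicator-no (Adj? (f 0F) (f 1F)) (proj₂ (onBlue 0F 1F refl))
              | indicator-no (Adj? (f 0F) (f 3F)) (proj₂ (onBlue 0F 3F refl))
              | indicator-no (Adj? (f 1F) (f 3F)) (proj₂ (onBlue 1F 3F refl)) = ℤ.≤-refl

    ∑weight₃ : ∀ x₀ x₁ → ∑ (λ x₃ → (1ℤ - R x₀ x₃) * (1ℤ - R x₁ x₃)) ≡ n + - 1ℤ * d x₀ + - 1ℤ * d x₁ + 1ℤ * c x₀ x₁
    ∑weight₃ x₀ x₁ = trans (∑-cong λ x₃ → lemma (R x₀ x₃) (R x₁ x₃))
      (trans (∑-snoc (λ x₃ → 1ℤ + - 1ℤ * R x₀ x₃ + - 1ℤ * R x₁ x₃) 1ℤ (λ x₃ → R x₀ x₃ * R x₁ x₃))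
        (cong (λ i → i + 1ℤ * c x₀ x₁)
      (trans (∑-snoc (λ x₃ → 1ℤ + - 1ℤ * R x₀ x₃) (- 1ℤ) (R x₁)) (cong (λ i → i + - 1ℤ * d x₁)
      (trans (∑-snoc (λ x₃ → 1ℤ) (- 1ℤ) (R x₀)) (cong (λ i → i + - 1ℤ * d x₀) (trans (∑-const N 1ℤ) (ℤ.*-identityʳ n))))))))
      where
      lemma : ∀ p q → (1ℤ - p) * (1ℤ - q) ≡ 1ℤ + - 1ℤ * p + - 1ℤ * q + 1ℤ * (p * q)
      lemma = solve-∀

    -- Once x₀ is fixed, x₂ is chosen independently of the pair x₁, x₃; this is the product of `d`
    -- and `rest`.
    ∑weight : ∑ (λ x₀ → ∑ λ x₁ → ∑ λ x₂ → ∑ λ x₃ → weight x₀ x₁ x₂ x₃) ≡ Λ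
    ∑weight = ∑-cong λ x₀ → trans (∑-cong λ x₁ → pair x₀ x₁)
      (trans (∑-*ˡ (d x₀) (λ x₁ → (1ℤ - R x₀ x₁) * (n + - 1ℤ * d x₀ + - 1ℤ * d x₁ + 1ℤ * c x₀ x₁)))
        (cong (λ i → d x₀ * i) (trans (∑-cong λ x₁ → lemma n (d x₀) (R x₀ x₁) (d x₁) (c x₀ x₁))
          (trans (∑-linear (n - d x₀) (- 1ℤ) 1ℤ 1ℤ (- (n - d x₀)) (- 1ℤ) x₀)
            (lemma′ n (d x₀) e (s x₀) (t x₀))))))
      where
      pair : ∀ x₀ x₁ → ∑ (λ x₂ → ∑ λ x₃ → weight x₀ x₁ x₂ x₃) ≡
        d x₀ * ((1ℤ - R x₀ x₁) * (n + - 1ℤ * d x₀ + - 1ℤ * d x₁ + 1ℤ * c x₀ x₁))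
      pair x₀ x₁ = begin
        ∑ (λ x₂ → ∑ λ x₃ → weight x₀ x₁ x₂ x₃)
          ≡⟨ ∑-cong (λ x₂ → trans (∑-*ˡ ((1ℤ - R x₀ x₁) * R x₀ x₂) (λ x₃ → (1ℤ - R x₀ x₃) * (1ℤ - R x₁ x₃)))
               (cong (λ i → ((1ℤ - R x₀ x₁) * R x₀ x₂) * i) (∑weight₃ x₀ x₁))) ⟩
        ∑ (λ x₂ → ((1ℤ - R x₀ x₁) * R x₀ x₂) * k)  ≡⟨ ∑-*ʳ k (λ x₂ → (1ℤ - R x₀ x₁) * R x₀ x₂) ⟩
        ∑ (λ x₂ → (1ℤ - R x₀ x₁) * R x₀ x₂) * k    ≡⟨ cong (λ i → i * k) (∑-*ˡ (1ℤ - R x₀ x₁) (R x₀)) ⟩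
        (1ℤ - R x₀ x₁) * d x₀ * k                  ≡⟨ lemma″ (1ℤ - R x₀ x₁) (d x₀) k ⟩
        d x₀ * ((1ℤ - R x₀ x₁) * k)                ∎
        where
        open ≡-Reasoning
        k = n + - 1ℤ * d x₀ + - 1ℤ * d x₁ + 1ℤ * c x₀ x₁
        lemma″ : ∀ p q k → p * q * k ≡ q * (p * k)
        lemma″ = solve-∀
      lemma : ∀ n d R D c → (1ℤ - R) * (n + - 1ℤ * d + - 1ℤ * D + 1ℤ * c) ≡
        (n - d) * 1ℤ + - 1ℤ * D + 1ℤ * c + 1ℤ * (R * D) + - (n - d) * R + - 1ℤ * (R * c)
      lemma = solve-∀
      lemma′ : ∀ n d e s t → (n - d) * n + - 1ℤ * e + 1ℤ * s + 1ℤ * s + - (n - d) * d + - 1ℤ * t ≡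
        (n - d) * ((n - d) * 1ℤ) - (e - + 2 * s + t)
      lemma′ = solve-∀

    embeddingCount≤Λ : + embeddingCount H G ≤ Λ
    embeddingCount≤Λ = subst (+ embeddingCount H G ≤_) (trans expand ∑weight)
      (length-filter-≤ (isEmbedding? H G) embedding-≤ (functions 4 N))
      where
      g : (Fin 4 → Fin N) → ℤ
      g f = weight (f 0F) (f 1F) (f 2F) (f 3F)
      expand : total g (functions 4 N) ≡ ∑ (λ x₀ → ∑ λ x₁ → ∑ λ x₂ → ∑ λ x₃ → weight x₀ x₁ x₂ x₃)
      expand = trans (total-functions 3 N g) (∑-cong λ x₀ →
        trans (total-functions 2 N (λ f → g (x₀ Vector.∷ f))) (∑-cong λ x₁ →
        trans (total-functions 1 N (λ f → g (x₀ Vector.∷ x₁ Vector.∷ f))) (∑-cong λ x₂ →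
        trans (total-functions 0 N (λ f → g (x₀ Vector.∷ x₁ Vector.∷ x₂ Vector.∷ f))) (∑-cong λ x₃ →
          ℤ.+-identityʳ (weight x₀ x₁ x₂ x₃)))))

  -- Permutations that sort a bipartition.

  module ℕExtrema = Extrema ℕ.≤-totalOrder

  functions-complete : ∀ k n (f : Fin k → Fin n) → ∃[ f′ ] (f′ ∈ functions k n × f′ ≗ f)
  functions-complete zero    n f = Vector.[] , here refl , λ ()
  functions-complete (suc k) n f with functions-complete k n (f ∘ suc)
  ... | f′ , f′∈ , f′≗ = (f zero Vector.∷ f′) , ∈-cartesianProductWith⁺ Vector._∷_ (∈-allFin (f zero)) f′∈ ,
    λ { zero → refl ; (suc i) → f′≗ i }

  permutation-injective : ∀ {n} (π : Permutation n n) {x y} → π ⟨$⟩ʳ x ≡ π ⟨$⟩ʳ y → x ≡ y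
  permutation-injective π {x} {y} eq = trans (sym (inverseˡ π)) (trans (cong (π ⟨$⟩ˡ_) eq) (inverseˡ π))

  below : ∀ {n} → ℕ → Fin n → ℤ
  below k i = indicator (toℕ i ℕ.<? k)

  below-bit : ∀ {n} k (i : Fin n) → below k i ≡ 0ℤ ⊎ below k i ≡ 1ℤ
  below-bit k i = indicator-bit (toℕ i ℕ.<? k)

  below-suc : ∀ {n} k (i : Fin n) → below (suc k) (suc i) ≡ below k i
  below-suc k i = indicator-cong (suc (toℕ i) ℕ.<? suc k) (toℕ i ℕ.<? k) ℕ.s≤s⁻¹ s≤s

  -- `punchIn j` fixes the positions below j and shifts the others up, so no position crosses j.
  below-punchIn : ∀ {n} (j : Fin (suc n)) i → below (toℕ j) (punchIn j i) ≡ below (toℕ j) i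
  below-punchIn zero    i       = refl
  below-punchIn (suc j) zero    = refl
  below-punchIn (suc j) (suc i) = trans (below-suc (toℕ j) (punchIn j i))
    (trans (below-punchIn j i) (sym (below-suc (toℕ j) i)))

  ∑-below : ∀ {n k} → k ℕ.≤ n → ∑ {n} (below k) ≡ + k
  ∑-below {zero}  {zero}  _ = ∑-empty (below 0)
  ∑-below {suc n} {zero}  _ = trans (∑-suc (below {suc n} 0)) (trans (ℤ.+-identityˡ _) (∑-below {n} {0} z≤n))
  ∑-below {suc n} {suc k} (s≤s k≤n) = trans (∑-suc (below {suc n} (suc k)))
    (cong (λ i → 1ℤ + i) (trans (∑-cong (below-suc k)) (∑-below k≤n)))

  indicator-× : ∀ {A B C : Set} (a? : Dec A) (b? : Dec B) (c? : Dec C) →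
    (A → B → C) → (C → A) → (C → B) → indicator a? * indicator b? ≡ indicator c?
  indicator-× (yes a) (yes b) c? f _ _ = sym (indicator-yes c? (f a b))
  indicator-× (yes a) (no ¬b) c? _ _ h = sym (indicator-no c? (¬b ∘ h))
  indicator-× (no ¬a) b?      c? _ g _ = trans (ℤ.*-zeroˡ (indicator b?)) (sym (indicator-no c? (¬a ∘ g)))

  -- One side of `balancedCompleteBipartite` is an initial segment, so a neighbourhood is best
  -- compared with it after being moved to an initial segment too.
  record Sorting {n : ℕ} (f : Fin n → ℤ) : Set where
    constructor sorting
    field
      {threshold} : ℕ
      threshold≤n : threshold ℕ.≤ n
      σ           : Permutation n n
      sorted      : ∀ i → f i ≡ below threshold (σ ⟨$⟩ʳ i)

  sort : ∀ {n} (f : Fin n → ℤ) → (∀ i → f i ≡ 0ℤ ⊎ f i ≡ 1ℤ) → Sorting f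
  sort {zero}  f bits = sorting z≤n Permutation.id λ ()
  sort {suc n} f bits = extend (sort (f ∘ suc) (bits ∘ suc)) (bits zero)
    where
    extend : Sorting (f ∘ suc) → f zero ≡ 0ℤ ⊎ f zero ≡ 1ℤ → Sorting f
    extend (sorting {k} k≤n π sorted) (inj₂ f₀≡1) = sorting (s≤s k≤n) (lift₀ π)
      λ { zero → f₀≡1 ; (suc i) → trans (sorted i) (sym (below-suc k (π ⟨$⟩ʳ i))) }
    -- A new zero goes to position k, just after the ones; a new one goes to the front.
    extend (sorting {k} k≤n π sorted) (inj₁ f₀≡0) = sorting (ℕ.m≤n⇒m≤1+n k≤n) (insert zero j π) λ
      { zero    → trans f₀≡0 (sym (indicator-no (toℕ j ℕ.<? k) (ℕ.<-irrefl (Fin.toℕ-fromℕ< (s≤s k≤n)))))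
      ; (suc i) → trans (sorted i) (sym (subst (λ m → below m (punchIn j (π ⟨$⟩ʳ i)) ≡ below m (π ⟨$⟩ʳ i))
                    (Fin.toℕ-fromℕ< (s≤s k≤n)) (below-punchIn j (π ⟨$⟩ʳ i)))) }
      where
      j : Fin (suc n)
      j = fromℕ< (s≤s k≤n)

  opaque
    unfolding ∑
    ∑-permute : ∀ {n} (f : Fin n → ℤ) (π : Permutation n n) → ∑ f ≡ ∑ (λ i → f (π ⟨$⟩ʳ i))
    ∑-permute = CommutativeMonoidSum.∑-permute ℤ.+-0-commutativeMonoid

  total-allFin : ∀ {A : Set} (g : A → ℤ) {n} (h : Fin n → A) → total g (tabulate h) ≡ ∑ (g ∘ h)
  total-allFin g {zero}  h = sym (∑-empty (g ∘ h))
  total-allFin g {suc n} h = trans (cong (λ i → g (h zero) + i) (total-allFin g (h ∘ suc))) (sym (∑-suc (g ∘ h)))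

  bit : Fin 2 → ℤ
  bit b = + toℕ b

  toBit : ∀ {i} → i ≡ 0ℤ ⊎ i ≡ 1ℤ → ∃[ b ] i ≡ bit b
  toBit (inj₁ eq) = 0F , eq
  toBit (inj₂ eq) = 1F , eq

  -- p is the side of the balanced bipartition and q that of the bipartition given
  -- by a neighbourhood: a pair with adjacency r costs 1 if it is wrong for q, and 1
  -- more for each end at which p and q disagree.
  cost : (r q q′ p p′ : ℤ) → ℤ
  cost r q q′ p p′ = q * (+ 2 * (q′ * r) + 1ℤ - q′ - r) + (1ℤ - q) * (r + q′ - + 2 * (q′ * r))
    + (q + p - + 2 * (q * p)) + (q′ + p′ - + 2 * (q′ * p′))

  differs : (r p p′ : ℤ) → ℤ
  differs r p p′ = r * (p * p′ + (1ℤ - p) * (1ℤ - p′)) + (1ℤ - r) * (p * (1ℤ - p′) + (1ℤ - p) * p′)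

  -- If p and q agree at both ends, the two sides are equal; otherwise the disagreement costs at
  -- least 1, and the left side is at most 1. All 32 cases are evaluated.
  differs≤cost : ∀ {r q q′ p p′} → r ≡ 0ℤ ⊎ r ≡ 1ℤ → q ≡ 0ℤ ⊎ q ≡ 1ℤ → q′ ≡ 0ℤ ⊎ q′ ≡ 1ℤ →
    p ≡ 0ℤ ⊎ p ≡ 1ℤ → p′ ≡ 0ℤ ⊎ p′ ≡ 1ℤ → differs r p p′ ≤ cost r q q′ p p′
  differs≤cost r q q′ p p′ with toBit r | toBit q | toBit q′ | toBit p | toBit p′
  ... | r , refl | q , refl | q′ , refl | p , refl | p′ , refl =
    from-yes (Fin.all? λ r → Fin.all? λ q → Fin.all? λ q′ → Fin.all? λ p → Fin.all? λ p′ →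
      differs (bit r) (bit p) (bit p′) ℤ.≤? cost (bit r) (bit q) (bit q′) (bit p) (bit p′)) r q q′ p p′

  -- The edit distance is at most `bad v`.

  module Editing {N : ℕ} (G : Graph N) (0<n : 0ℤ < + N) where
    open Graph G using (Adj; Adj?)
    open Counts G
    open Weights R R-bit R-sym hiding (π)
    open Stability R R-bit R-sym 0<n

    h : ℕ
    h = ⌊ N /2⌋

    module _ (π : Permutation N N) (f : Fin N → Fin N) (f≗π : f ≗ (π ⟨$⟩ʳ_)) where

      f-injective : ∀ {x y} → f x ≡ f y → x ≡ y
      f-injective {x} {y} eq = permutation-injective π (trans (sym (f≗π x)) (trans eq (f≗π y)))

      f-π⁻¹ : ∀ y → f (π ⟨$⟩ˡ y) ≡ y
      f-π⁻¹ y = trans (f≗π (π ⟨$⟩ˡ y)) (inverseʳ π)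

      f-bijective : IsBijection f
      f-bijective = f-injective , λ y → π ⟨$⟩ˡ y , f-π⁻¹ y

      image : ∀ x y → indicator (inImage? G (balancedCompleteBipartite N) f x y) ≡ R (π ⟨$⟩ˡ x) (π ⟨$⟩ˡ y)
      image x y = indicator-cong (inImage? G (balancedCompleteBipartite N) f x y) (Adj? (π ⟨$⟩ˡ x) (π ⟨$⟩ˡ y))
        (λ { (u , v , refl , refl , uv) → subst₂ Adj
          (f-injective (sym (f-π⁻¹ (f u)))) (f-injective (sym (f-π⁻¹ (f v)))) uv })
        (λ uv → π ⟨$⟩ˡ x , π ⟨$⟩ˡ y , f-π⁻¹ x , f-π⁻¹ y , uv)

      difference-≤ : ∀ x y → indicator (inDifference? G (balancedCompleteBipartite N) f (x , y))
        ≤ differs (R (π ⟨$⟩ˡ x) (π ⟨$⟩ˡ y)) (below h x) (below h y)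
      difference-≤ x y = subst
        (λ r → indicator (inDifference? G (balancedCompleteBipartite N) f (x , y)) ≤ differs r (below h x) (below h y))
        (image x y)
        (truthTable (does (inImage? G (balancedCompleteBipartite N) f x y)) (does (toℕ x ℕ.<? h)) (does (toℕ y ℕ.<? h)))
        where
        toℤ : Bool → ℤ
        toℤ b = if b then 1ℤ else 0ℤ
        -- The `does` of `inDifference?` computes to this Boolean formula in the three elementary
        -- decisions.
        truthTable : ∀ i l m →
          toℤ ((i ∧ not ((l ∧ not m) ∨ (not l ∧ m))) ∨ (not i ∧ ((l ∧ not m) ∨ (not l ∧ m))))
            ≤ differs (toℤ i) (toℤ l) (toℤ m)
        truthTable false false false = ℤ.≤-refl
        truthTable false false true  = ℤ.≤-refl
        truthTable false true  false = ℤ.≤-refl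
        truthTable false true  true  = ℤ.≤-refl
        truthTable true  false false = ℤ.≤-refl
        truthTable true  false true  = ℤ.≤-refl
        truthTable true  true  false = ℤ.≤-refl
        truthTable true  true  true  = ℤ.≤-refl

    module _ (v : Fin N) (sorting′ : Sorting (R v)) where
      open Sorting sorting′

      -- `m u` is 1 if the two bipartitions disagree at u and 0 otherwise.
      q p m : Fin N → ℤ
      q = R v
      p u = below h (σ ⟨$⟩ʳ u)
      m u = q u + p u - + 2 * (q u * p u)

      M : ℤ
      M = ∑ m

      d≡threshold : d v ≡ + threshold
      d≡threshold = trans (∑-cong sorted) (trans (sym (∑-permute (below threshold) σ)) (∑-below threshold≤n))

      m-sum : M ≡ ∑ (λ x → below threshold x + below h x + - (+ 2) * (below threshold x * below h x))
      m-sum = trans (∑-cong λ u → trans (cong (λ i → i + p u - + 2 * (i * p u)) (sorted u))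
          (lemma (below threshold (σ ⟨$⟩ʳ u)) (p u)))
        (sym (∑-permute (λ x → below threshold x + below h x + - (+ 2) * (below threshold x * below h x)) σ))
        where
        lemma : ∀ q p → q + p - + 2 * (q * p) ≡ q + p + - (+ 2) * (q * p)
        lemma = solve-∀

      -- After sorting, two initial segments are compared, of sizes d v and ⌊n/2⌋; they differ in |d
      -- v - ⌊n/2⌋| elements. The extra 1 pays for rounding when n is odd.
      2M≤ : + 2 * M ≤ a v + 1ℤ
      2M≤ = subst (λ i → + 2 * M ≤ + ∣ + 2 * i - n ∣ + 1ℤ) (sym d≡threshold)
        (subst (λ i → + 2 * i ≤ + ∣ + 2 * + threshold - n ∣ + 1ℤ)
          (trans (sym evaluate) (sym m-sum)) ([ lower , upper ]′ (ℕ.≤-total threshold h)))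
        where
        k = threshold
        value : ℤ
        value = + k + + h + - (+ 2) * + (k ℕ.⊓ h)
        product : ∀ (x : Fin N) → below k x * below h x ≡ below (k ℕ.⊓ h) x
        product x = indicator-× (toℕ x ℕ.<? k) (toℕ x ℕ.<? h) (toℕ x ℕ.<? k ℕ.⊓ h) ℕ.⊓-pres-m<
          (λ x< → ℕ.<-≤-trans x< (ℕ.m⊓n≤m k h)) (λ x< → ℕ.<-≤-trans x< (ℕ.m⊓n≤n k h))
        evaluate : ∑ (λ x → below k x + below h x + - (+ 2) * (below k x * below h x)) ≡ value
        evaluate = trans (∑-snoc (λ x → below k x + below h x) (- (+ 2)) (λ x → below k x * below h x))
          (cong₂ (λ i j → i + - (+ 2) * j)
            (trans (∑-+ (below k) (below h)) (cong₂ _+_ (∑-below threshold≤n) (∑-below (ℕ.⌊n/2⌋≤n N))))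
            (trans (∑-cong product) (∑-below (ℕ.≤-trans (ℕ.m⊓n≤m k h) threshold≤n))))
        halves : ∀ n → ⌊ n /2⌋ ℕ.+ ⌊ n /2⌋ ℕ.≤ n × n ℕ.≤ suc (⌊ n /2⌋ ℕ.+ ⌊ n /2⌋)
        halves zero          = z≤n , z≤n
        halves (suc zero)    = z≤n , s≤s z≤n
        halves (suc (suc n)) with halves n
        ... | 2h≤n , n≤1+2h rewrite ℕ.+-suc ⌊ n /2⌋ ⌊ n /2⌋ = s≤s (s≤s 2h≤n) , s≤s (s≤s n≤1+2h)
        lower : k ℕ.≤ h → + 2 * value ≤ + ∣ + 2 * + k - n ∣ + 1ℤ
        lower k≤h = subst (λ j → + 2 * (+ k + + h + - (+ 2) * + j) ≤ + ∣ + 2 * + k - n ∣ + 1ℤ) (sym (ℕ.m≤n⇒m⊓n≡m k≤h))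
          (ℤ.≤-trans (subst₂ _≤_ (lemma (+ k) (+ h)) (lemma′ (+ k) n)
              (ℤ.+-monoʳ-≤ (- (+ 2 * + k)) (+≤+ (proj₁ (halves N)))))
            (ℤ.≤-trans (-i≤∣i∣ (+ 2 * + k - n)) (ℤ.i≤i+j (+ ∣ + 2 * + k - n ∣) 1ℤ)))
          where
          lemma : ∀ k h → - (+ 2 * k) + (h + h) ≡ + 2 * (k + h + - (+ 2) * k)
          lemma = solve-∀
          lemma′ : ∀ k n → - (+ 2 * k) + n ≡ - (+ 2 * k - n)
          lemma′ = solve-∀
        upper : h ℕ.≤ k → + 2 * value ≤ + ∣ + 2 * + k - n ∣ + 1ℤ
        upper h≤k = subst (λ j → + 2 * (+ k + + h + - (+ 2) * + j) ≤ + ∣ + 2 * + k - n ∣ + 1ℤ) (sym (ℕ.m≥n⇒m⊓n≡n h≤k))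
          (ℤ.≤-trans (ℤ.0≤i-j⇒j≤i (subst (0ℤ ≤_) (lemma (+ k) (+ h) n) (ℤ.i≤j⇒0≤j-i (+≤+ (proj₂ (halves N))))))
            (ℤ.+-monoˡ-≤ 1ℤ (i≤∣i∣ (+ 2 * + k - n))))
          where
          lemma : ∀ k h n → 1ℤ + (h + h) - n ≡ + 2 * k - n + 1ℤ - + 2 * (k + h + - (+ 2) * h)
          lemma = solve-∀

      -- Wrong pairs within the sides give t + r, wrong pairs across give ρ in each order, and each
      -- disagreement is charged n times at either end of a pair.
      ∑cost : ∑ (λ u → ∑ λ w → cost (R u w) (q u) (q w) (p u) (p w)) ≡ t v + r v + + 2 * ρ v + n * (+ 2 * M)
      ∑cost = trans (∑-cong λ u → trans (∑-cong λ w → lemma (R u w) (q u) (q w) (p u) (m w)) (row u)) (trans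
        (∑-cong λ u → lemma′ (q u) (m u) (d u) (d v) (c v u) M n)
        (trans (∑-snoc (λ u → (d v + M) * 1ℤ + 1ℤ * d u + - (+ 2) * c v u + - (+ 2) * (q u * d u)
            + (n - + 2 * d v) * q u + + 4 * (q u * c v u)) n m)
          (trans (cong (λ i → i + n * M) (∑-linear (d v + M) 1ℤ (- (+ 2)) (- (+ 2)) (n - + 2 * d v) (+ 4) v))
            (lemma″ n (d v) e (s v) (t v) M))))
        where
        row : ∀ u → ∑ (λ w → (q u + m u) * 1ℤ + (1ℤ - + 2 * q u) * R u w + (1ℤ - + 2 * q u) * q w
            + (+ 4 * q u - + 2) * (q w * R u w) + 1ℤ * m w)
          ≡ (q u + m u) * n + (1ℤ - + 2 * q u) * d u + (1ℤ - + 2 * q u) * d v + (+ 4 * q u - + 2) * c v u + 1ℤ * M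
        row u = trans (∑-snoc (λ w → (q u + m u) * 1ℤ + (1ℤ - + 2 * q u) * R u w + (1ℤ - + 2 * q u) * q w
            + (+ 4 * q u - + 2) * (q w * R u w)) 1ℤ m)
          (cong (λ i → i + 1ℤ * M)
          (trans (∑-snoc (λ w → (q u + m u) * 1ℤ + (1ℤ - + 2 * q u) * R u w + (1ℤ - + 2 * q u) * q w)
            (+ 4 * q u - + 2) (λ w → q w * R u w))
          (cong (λ i → i + (+ 4 * q u - + 2) * c v u)
          (trans (∑-snoc (λ w → (q u + m u) * 1ℤ + (1ℤ - + 2 * q u) * R u w) (1ℤ - + 2 * q u) q)
          (cong (λ i → i + (1ℤ - + 2 * q u) * d v)
          (trans (∑-snoc (λ w → (q u + m u) * 1ℤ) (1ℤ - + 2 * q u) (R u))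
          (cong (λ i → i + (1ℤ - + 2 * q u) * d u)
          (trans (∑-*ˡ (q u + m u) (λ _ → 1ℤ)) (cong (λ i → (q u + m u) * i) (trans (∑-const N 1ℤ) (ℤ.*-identityʳ n)))))))))))
        lemma : ∀ r q q′ p m′ → q * (+ 2 * (q′ * r) + 1ℤ - q′ - r) + (1ℤ - q) * (r + q′ - + 2 * (q′ * r))
            + (q + p - + 2 * (q * p)) + m′
          ≡ (q + (q + p - + 2 * (q * p))) * 1ℤ + (1ℤ - + 2 * q) * r + (1ℤ - + 2 * q) * q′
            + (+ 4 * q - + 2) * (q′ * r) + 1ℤ * m′
        lemma = solve-∀
        lemma′ : ∀ q m D d c M n → (q + m) * n + (1ℤ - + 2 * q) * D + (1ℤ - + 2 * q) * d + (+ 4 * q - + 2) * c + 1ℤ * M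
          ≡ (d + M) * 1ℤ + 1ℤ * D + - (+ 2) * c + - (+ 2) * (q * D) + (n - + 2 * d) * q + + 4 * (q * c) + n * m
        lemma′ = solve-∀
        lemma″ : ∀ n d e s t M → (d + M) * n + 1ℤ * e + - (+ 2) * s + - (+ 2) * s + (n - + 2 * d) * d + + 4 * t + n * M
          ≡ t + (e - + 2 * s + t) + + 2 * (d * (n - d) - s + t) + n * (+ 2 * M)
        lemma″ = solve-∀

      differenceSize≤bad : ∀ f → f ≗ (σ ⟨$⟩ʳ_) → + differenceSize G (balancedCompleteBipartite N) f ≤ bad v
      differenceSize≤bad f f≗σ = ℤ.≤-trans
        (length-filter-≤ _ {g} pointwise (cartesianProduct (allFin N) (allFin N)))
        (subst (_≤ bad v) (sym (trans regroup reindex)) (ℤ.≤-trans (∑-mono λ u → ∑-mono λ w →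
            differs≤cost (R-bit u w) (R-bit v u) (R-bit v w) (below-bit h (σ ⟨$⟩ʳ u)) (below-bit h (σ ⟨$⟩ʳ w)))
          (subst (_≤ bad v) (sym ∑cost) (ℤ.+-monoʳ-≤ (t v + r v + + 2 * ρ v) (*-monoˡ n 0≤n 2M≤)))))
        where
        g : Fin N × Fin N → ℤ
        g (x , y) = differs (R (σ ⟨$⟩ˡ x) (σ ⟨$⟩ˡ y)) (below h x) (below h y)
        indicator-×-≤ : ∀ {A B : Set} (a? : Dec A) (b? : Dec B) → indicator (a? ×-dec b?) ≤ indicator b?
        indicator-×-≤ (yes _) b? = ℤ.≤-refl
        indicator-×-≤ (no _) b? with indicator-bit b?
        ... | inj₁ eq = ℤ.≤-reflexive (sym eq)
        ... | inj₂ eq = subst (0ℤ ≤_) (sym eq) (+≤+ z≤n)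
        -- Dropping the condition x < y counts each pair in both orders, which costs only a factor
        -- of two.
        pointwise : ∀ e → indicator ((proj₁ e Fin.<? proj₂ e) ×-dec inDifference? G (balancedCompleteBipartite N) f e) ≤ g e
        pointwise (x , y) = ℤ.≤-trans (indicator-×-≤ (x Fin.<? y) (inDifference? G (balancedCompleteBipartite N) f (x , y)))
          (difference-≤ σ f f≗σ x y)
        regroup : total g (cartesianProduct (allFin N) (allFin N)) ≡ ∑ λ x → ∑ λ y → g (x , y)
        regroup = trans (total-product g _,_ id (allFin N)) (∑-cong λ x → total-allFin (λ y → g (x , y)) id)
        reindex : (∑ λ x → ∑ λ y → g (x , y)) ≡ ∑ λ u → ∑ λ w → differs (R u w) (p u) (p w)
        reindex = trans (∑-permute (λ x → ∑ λ y → g (x , y)) σ) (∑-cong λ u →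
          trans (∑-permute (λ y → g (σ ⟨$⟩ʳ u , y)) σ) (∑-cong λ w →
            cong₂ (λ i j → differs (R i j) (p u) (p w)) (inverseˡ σ) (inverseˡ σ)))

    editDistance≤bad : ∀ v → + editDistance G (balancedCompleteBipartite N) ≤ bad v
    editDistance≤bad v with sort (R v) (R-bit v)
    ... | sorted@(sorting _ σ _) with functions-complete N N (σ ⟨$⟩ʳ_)
    ... | f , f∈ , f≗σ = ℤ.≤-trans (+≤+ (ℕExtrema.min≤v⁺ (differenceSize G (balancedCompleteBipartite N) id)
        (map (differenceSize G (balancedCompleteBipartite N)) (bijections N))
        (inj₂ (lose (∈-map⁺ (differenceSize G (balancedCompleteBipartite N))
          (∈-filter⁺ isBijection? f∈ (f-bijective σ f f≗σ))) ℕ.≤-refl))))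
      (differenceSize≤bad v sorted f f≗σ)

  -- With n = 4 + x both differences become polynomials in x with non-negative coefficients. The 6
  -- is 1 + 2 + 3.
  fallingFactorial-bounds : ∀ {n} → 4 ℕ.≤ n →
    (+ n) ^ 4 ≤ + (n P 4) + + 6 * (+ n) ^ 3 × + (n P 4) ≤ (+ n) ^ 4
  fallingFactorial-bounds (s≤s (s≤s (s≤s (s≤s {n = k} z≤n)))) =
    subst (λ p → n ^ 4 ≤ p + + 6 * n ^ 3 × p ≤ n ^ 4) (sym factors)
      ( ℤ.0≤i-j⇒j≤i (subst (0ℤ ≤_) (lower x) (0≤i+j {+ 11 * (x * x) + + 82 * x} {+ 152}
          (0≤i+j {+ 11 * (x * x)} {+ 82 * x} (0≤i*j {+ 11} {x * x} (+≤+ z≤n) 0≤x²)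
            (0≤i*j {+ 82} {x} (+≤+ z≤n) 0≤x)) (+≤+ z≤n)))
      , ℤ.0≤i-j⇒j≤i (subst (0ℤ ≤_) (upper x) (0≤i+j {+ 6 * (x * x * x) + + 61 * (x * x) + + 206 * x} {+ 232}
          (0≤i+j {+ 6 * (x * x * x) + + 61 * (x * x)} {+ 206 * x}
            (0≤i+j {+ 6 * (x * x * x)} {+ 61 * (x * x)}
              (0≤i*j {+ 6} {x * x * x} (+≤+ z≤n) (0≤i*j {x * x} {x} 0≤x² 0≤x)) (0≤i*j {+ 61} {x * x} (+≤+ z≤n) 0≤x²))
            (0≤i*j {+ 206} {x} (+≤+ z≤n) 0≤x)) (+≤+ z≤n))))
    where
    x n : ℤ
    x = + k
    n = + (4 ℕ.+ k)
    0≤x : 0ℤ ≤ x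
    0≤x = +≤+ z≤n
    0≤x² : 0ℤ ≤ x * x
    0≤x² = 0≤i*i x
    product : ℤ
    product = (+ 1 + x) * ((+ 2 + x) * ((+ 3 + x) * ((+ 4 + x) * 1ℤ)))
    factors : + ((4 ℕ.+ k) P 4) ≡ product
    factors = trans (ℤ.pos-* (1 ℕ.+ k) ((2 ℕ.+ k) ℕ.* ((3 ℕ.+ k) ℕ.* ((4 ℕ.+ k) ℕ.* 1)))) (cong ((+ 1 + x) *_)
      (trans (ℤ.pos-* (2 ℕ.+ k) ((3 ℕ.+ k) ℕ.* ((4 ℕ.+ k) ℕ.* 1))) (cong ((+ 2 + x) *_)
      (trans (ℤ.pos-* (3 ℕ.+ k) ((4 ℕ.+ k) ℕ.* 1)) (cong ((+ 3 + x) *_) (ℤ.pos-* (4 ℕ.+ k) 1))))))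
    lower : ∀ x → + 11 * (x * x) + + 82 * x + + 152 ≡
      (+ 1 + x) * ((+ 2 + x) * ((+ 3 + x) * ((+ 4 + x) * 1ℤ))) + + 6 * ((+ 4 + x) * ((+ 4 + x) * ((+ 4 + x) * 1ℤ)))
      - (+ 4 + x) * ((+ 4 + x) * ((+ 4 + x) * ((+ 4 + x) * 1ℤ)))
    lower = solve-∀
    upper : ∀ x → + 6 * (x * x * x) + + 61 * (x * x) + + 206 * x + + 232 ≡
      (+ 4 + x) * ((+ 4 + x) * ((+ 4 + x) * ((+ 4 + x) * 1ℤ)))
      - (+ 1 + x) * ((+ 2 + x) * ((+ 3 + x) * ((+ 4 + x) * 1ℤ)))
    upper = solve-∀

  -- From the density to the deficit.

  module _ {N : ℕ} (G : Graph N) (4≤N : 4 ℕ.≤ N) (j : ℕ) (0<j : 0 ℕ.< j) where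
    private
      n J : ℤ
      n = + N
      J = + j

      0<n : 0ℤ < n
      0<n = +<+ (ℕ.<-≤-trans (s≤s z≤n) 4≤N)

    open Counts G using (R; R-bit; R-sym; embeddingCount≤Λ)
    open Weights R R-bit R-sym using (Λ; Δ)
    open Editing G 0<n using (editDistance≤bad)
    open Stability.Conclusion R R-bit R-sym 0<n J (+ editDistance G (balancedCompleteBipartite N)) (+<+ 0<j)

    close : ∀ m → + m ≡ K⁸ → 192 ℕ.* m ℕ.≤ N →
      (+ 256 * + m - + 8) * + (N P 4) ≤ + embeddingCount H G * (+ 8 * (+ 256 * + m)) →
      J * + editDistance G (balancedCompleteBipartite N) ≤ n * n
    close m m≡K⁸ 192m≤N dense = J*E≤n²
      (subst (λ k → + 16 * k * Δ ≤ n ^ 4) m≡K⁸ 16mΔ≤n⁴) 4J≤n editDistance≤bad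
      where
      K≤m : K ≤ + m
      K≤m = subst (K ≤_) (sym m≡K⁸) (ℤ.≤-trans {K} {K²} (i≤i*i 0<K) (ℤ.≤-trans {K²} {K⁴} (i≤i*i 0<K²) (i≤i*i 0<K⁴)))
      192m≤n : + 192 * + m ≤ n
      192m≤n = subst (_≤ n) (ℤ.pos-* 192 m) (+≤+ 192m≤N)
      4J≤n : + 4 * J ≤ n
      4J≤n = ℤ.≤-trans {+ 4 * J} {+ 192 * + m} (ℤ.≤-trans {+ 4 * J} {K}
          (*-mono {+ 4} {+ 34} {J} {J} (+≤+ z≤n) (+≤+ z≤n) (+≤+ (s≤s (s≤s (s≤s (s≤s z≤n))))) ℤ.≤-refl)
          (ℤ.≤-trans {K} {+ m} K≤m (subst (_≤ + 192 * + m) (ℤ.*-identityˡ (+ m))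
            (*-mono {1ℤ} {+ 192} {+ m} {+ m} (+≤+ z≤n) (+≤+ z≤n) (+≤+ (s≤s z≤n)) ℤ.≤-refl)))) 192m≤n
      p E : ℤ
      p = + (N P 4)
      E = + embeddingCount H G
      n⁴≤ : n ^ 4 ≤ p + + 6 * n ^ 3
      n⁴≤ = proj₁ (fallingFactorial-bounds 4≤N)
      p≤n⁴ : p ≤ n ^ 4
      p≤n⁴ = proj₂ (fallingFactorial-bounds 4≤N)
      0≤m : 0ℤ ≤ + m
      0≤m = +≤+ z≤n
      0≤n : 0ℤ ≤ n
      0≤n = +≤+ z≤n
      0≤n³ : 0ℤ ≤ n ^ 3
      0≤n³ = 0≤i*j {n} {n ^ 2} 0≤n (0≤i^2 n)
      -- The density gives 256m (p - 8E) ≤ 8p ≤ 8n⁴. Replacing p by n⁴ costs at most 256m · 6n³,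
      -- which is at most 8n⁴ as n ≥ 192m. Together 256mΔ ≤ 16n⁴.
      16mΔ≤n⁴ : + 16 * + m * Δ ≤ n ^ 4
      16mΔ≤n⁴ = *-cancelˡ (+ 16) {+ 16 * + m * Δ} {n ^ 4} (+<+ (s≤s z≤n)) (ℤ.0≤i-j⇒j≤i
        (subst (0ℤ ≤_) (lemma (+ m) n (n ^ 3) p E Λ)
          (0≤i+j {slack₁} {slack₂} (0≤i+j {slack₃} {slack₄} (0≤i+j {slack₅} {slack₆} 0≤₅ 0≤₆) 0≤₄) 0≤₂)))
        where
        slack₁ slack₂ slack₃ slack₄ slack₅ slack₆ : ℤ
        slack₂ = + 2048 * + m * (Λ - E)
        slack₄ = E * (+ 8 * (+ 256 * + m)) - (+ 256 * + m - + 8) * p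
        slack₅ = + 256 * + m * (p + + 6 * n ^ 3 - n * n ^ 3)
        slack₆ = + 8 * (n ^ 3 * (n - + 192 * + m)) + + 8 * (n * n ^ 3 - p)
        slack₃ = slack₅ + slack₆
        slack₁ = slack₃ + slack₄
        0≤₂ = 0≤i*j {+ 2048 * + m} {Λ - E} (0≤i*j {+ 2048} {+ m} (+≤+ z≤n) 0≤m) (ℤ.i≤j⇒0≤j-i embeddingCount≤Λ)
        0≤₄ = ℤ.i≤j⇒0≤j-i dense
        0≤₅ = 0≤i*j {+ 256 * + m} {p + + 6 * n ^ 3 - n * n ^ 3} (0≤i*j {+ 256} {+ m} (+≤+ z≤n) 0≤m) (ℤ.i≤j⇒0≤j-i n⁴≤)
        0≤₆ = 0≤i+j {+ 8 * (n ^ 3 * (n - + 192 * + m))} {+ 8 * (n * n ^ 3 - p)}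
          (0≤i*j {+ 8} {n ^ 3 * (n - + 192 * + m)} (+≤+ z≤n)
            (0≤i*j {n ^ 3} {n - + 192 * + m} 0≤n³ (ℤ.i≤j⇒0≤j-i 192m≤n)))
          (0≤i*j {+ 8} {n * n ^ 3 - p} (+≤+ z≤n) (ℤ.i≤j⇒0≤j-i p≤n⁴))
        lemma : ∀ m n n³ p E Λ →
          + 256 * m * (p + + 6 * n³ - n * n³)
          + (+ 8 * (n³ * (n - + 192 * m)) + + 8 * (n * n³ - p))
          + (E * (+ 8 * (+ 256 * m)) - (+ 256 * m - + 8) * p)
          + + 2048 * m * (Λ - E)
          ≡ + 16 * (n * n³) - + 16 * (+ 16 * m * (n * n³ - + 8 * Λ))
        lemma = solve-∀

-- Passing between rationals and integers.

open Counting
open import Data.Rational.Base as ℚ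
  using (ℚ; mkℚ; 0ℚ; _/_; _<_; _≤_; _≥_; _-_; _*_; *<*; toℚᵘ)

toℚᵘ-/ : ∀ i n .{{_ : ℕ.NonZero n}} → toℚᵘ (i / n) ℚᵘ.≃ i ℚᵘ./ n
toℚᵘ-/ i (suc n) = ℚ.toℚᵘ-fromℚᵘ (mkℚᵘ i n)

-- Unnormalised, 1/8 - 1/m is literally (m - 8)/(8m), so cross-multiplication gives the claim with
-- no common factors to cancel.
clear-denominators : ∀ count falling m .{{_ : ℕ.NonZero falling}} .{{_ : ℕ.NonZero m}} →
  + 1 / 8 - + 1 / m ≤ + count / falling → (+ m ℤ.- + 8) ℤ.* + falling ℤ.≤ + count ℤ.* (+ 8 ℤ.* + m)
clear-denominators count falling@(suc p) m@(suc k) density = subst₂ ℤ._≤_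
  (cong (λ i → i ℤ.* + falling) (lemma (+ m))) (cong (+ count ℤ.*_) (ℤ.pos-* 8 m)) (ℚᵘ.drop-*≤* (begin
  + 1 ℚᵘ./ 8 ℚᵘ.- + 1 ℚᵘ./ m            ≃⟨ ℚᵘ.+-cong (toℚᵘ-/ (+ 1) 8) (ℚᵘ.-‿cong (toℚᵘ-/ (+ 1) m)) ⟨
  toℚᵘ (+ 1 / 8) ℚᵘ.- toℚᵘ (+ 1 / m)    ≃⟨ ℚᵘ.+-congʳ (toℚᵘ (+ 1 / 8)) (ℚ.toℚᵘ-homo‿- (+ 1 / m)) ⟨
  toℚᵘ (+ 1 / 8) ℚᵘ.+ toℚᵘ (ℚ.- (+ 1 / m)) ≃⟨ ℚ.toℚᵘ-homo-+ (+ 1 / 8) (ℚ.- (+ 1 / m)) ⟨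
  toℚᵘ (+ 1 / 8 - + 1 / m)              ≤⟨ ℚ.toℚᵘ-mono-≤ density ⟩
  toℚᵘ (+ count / falling)              ≃⟨ toℚᵘ-/ (+ count) falling ⟩
  + count ℚᵘ./ falling                  ∎))
  where
  open ℚᵘ.≤-Reasoning
  lemma : ∀ m → + 1 ℤ.* m ℤ.+ (ℤ.- + 1) ℤ.* + 8 ≡ m ℤ.- + 8
  lemma = solve-∀

-- A positive rational is at least the reciprocal of its denominator, so only the denominator of ε
-- matters for the constants.
distance-≤ : ∀ ε distance n → 0ℚ < ε → + ℚ.denominatorℕ ε ℤ.* + distance ℤ.≤ + n ℤ.* + n →
  + distance / 1 ≤ ε * (+ (n ℕ.^ 2) / 1)
distance-≤ ε@(mkℚ +[1+ a ] d _) distance n _ J*distance≤n² = ℚ.toℚᵘ-cancel-≤ (begin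
  toℚᵘ (+ distance / 1)               ≃⟨ toℚᵘ-/ (+ distance) 1 ⟩
  + distance ℚᵘ./ 1                   ≤⟨ ℚᵘ.*≤* bound ⟩
  toℚᵘ ε ℚᵘ.* (+ (n ℕ.^ 2) ℚᵘ./ 1)    ≃⟨ ℚᵘ.*-congˡ {toℚᵘ ε} (toℚᵘ-/ (+ (n ℕ.^ 2)) 1) ⟨
  toℚᵘ ε ℚᵘ.* toℚᵘ (+ (n ℕ.^ 2) / 1)  ≃⟨ ℚ.toℚᵘ-homo-* ε (+ (n ℕ.^ 2) / 1) ⟨
  toℚᵘ (ε * (+ (n ℕ.^ 2) / 1))        ∎)
  where
  open ℚᵘ.≤-Reasoning
  bound : + distance ℤ.* + (suc d ℕ.* 1) ℤ.≤ +[1+ a ] ℤ.* + (n ℕ.^ 2) ℤ.* + 1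
  bound = subst₂ ℤ._≤_
    (trans (ℤ.*-comm (+ suc d) (+ distance)) (cong (λ k → + distance ℤ.* + k) (sym (ℕ.*-identityʳ (suc d)))))
    (sym (ℤ.*-identityʳ (+[1+ a ] ℤ.* + (n ℕ.^ 2))))
    (ℤ.≤-trans J*distance≤n² (subst₂ ℤ._≤_ (ℤ.*-identityˡ (+ n ℤ.* + n)) (cong (+[1+ a ] ℤ.*_) n²)
      (*-mono {1ℤ} {+[1+ a ]} {+ n ℤ.* + n} {+ n ℤ.* + n}
        (+≤+ z≤n) (0≤i*i (+ n)) (+≤+ (s≤s z≤n)) ℤ.≤-refl)))
    where
    n² : + n ℤ.* + n ≡ + (n ℕ.^ 2)
    n² = trans (sym (ℤ.pos-* n n)) (cong (λ k → + (n ℕ.* k)) (sym (ℕ.*-identityʳ n)))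
distance-≤ (mkℚ (+ zero) _ _) _ _ (*<* (+<+ ())) _
distance-≤ (mkℚ -[1+ _ ] _ _) _ _ (*<* ()) _

lemma3p14 :
  ∀ (ε : ℚ) → 0ℚ < ε →
    ∃[ δ ] (0ℚ < δ × ∃[ n₀ ]
      (∀ (n : ℕ) → n₀ ℕ.≤ n → (4≤n : 4 ℕ.≤ n) → (G : Graph n) →
       embeddingDensity H G 4≤n ≥ + 1 / 8 - δ →
       + editDistance G (balancedCompleteBipartite n) / 1 ≤ ε * (+ (n ℕ.^ 2) / 1)))
lemma3p14 ε 0<ε = δ , 0<δ , 192 ℕ.* m , λ n 192m≤n 4≤n G dense →
  distance-≤ ε (editDistance G (balancedCompleteBipartite n)) n 0<ε
    (close G 4≤n j (s≤s z≤n) m m≡K⁸ 192m≤n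
      (subst (λ i → (i ℤ.- + 8) ℤ.* + (n P 4) ℤ.≤ + embeddingCount H G ℤ.* (+ 8 ℤ.* i)) (ℤ.pos-* 256 m)
        (clear-denominators (embeddingCount H G) (n P 4) (256 ℕ.* m) {{P-nonZero 4 4≤n}} dense)))
  where
  j k k² k⁴ m : ℕ
  j = ℚ.denominatorℕ ε
  k = 34 ℕ.* j
  k² = k ℕ.* k
  k⁴ = k² ℕ.* k²
  -- The eighth power of K = 34J, with J the denominator of ε, as `16K⁸Δ≤n⁴` asks; δ and n₀ are
  -- fixed by it.
  m = k⁴ ℕ.* k⁴

  m≡K⁸ : + m ≡ (let K = + 34 ℤ.* + j ; K² = K ℤ.* K ; K⁴ = K² ℤ.* K² in K⁴ ℤ.* K⁴)
  m≡K⁸ = square k⁴ (square k² (square k (ℤ.pos-* 34 j)))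
    where
    square : ∀ a {i} → + a ≡ i → + (a ℕ.* a) ≡ i ℤ.* i
    square a refl = ℤ.pos-* a a

  instance
    m≢0 : ℕ.NonZero m
    m≢0 = ℕ.m*n≢0 k⁴ k⁴ {{k⁴≢0}} {{k⁴≢0}}
      where
      k≢0 : ℕ.NonZero k
      k≢0 = ℕ.m*n≢0 34 j
      k²≢0 : ℕ.NonZero k²
      k²≢0 = ℕ.m*n≢0 k k {{k≢0}} {{k≢0}}
      k⁴≢0 : ℕ.NonZero k⁴
      k⁴≢0 = ℕ.m*n≢0 k² k² {{k²≢0}} {{k²≢0}}

    256m≢0 : ℕ.NonZero (256 ℕ.* m)
    256m≢0 = ℕ.m*n≢0 256 m

  δ : ℚ
  δ = + 1 / (256 ℕ.* m)

  0<δ : 0ℚ < δ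
  0<δ = ℚ.positive⁻¹ δ {{ℚ.normalize-pos 1 (256 ℕ.* m)}}
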